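{- Let $s\ge2r\ge2$ be integers, let $x=(i,c)\le y=(j,d)$ be elements of the trapezoidal poset $T_{r,s}$, and put $$\ell=i-j,\qquad u=d-c,\qquad \delta=s-i-c.$$ For the interval $[x,y]$ of $T_{r,s}$ with the induced rank $\rho_{x,y}(z)=\rho(z)-\rho(x)$, where $\rho(i,c)=c-i$, one has $$\mathbb{H}_{[x,y],\rho_{x,y}}(q,t)=\Phi_{\ell,u}^{\delta}(t,q).$$ In particular, $$\mathbb{H}_{[x,y],\rho_{x,y}}(1,1)=\binom{\ell+u}{\ell}-\binom{\ell+u}{\ell+\delta+1}.$$ Thus the numerator of $[x,y]$ depends only on the displacement $(\ell,u)$ and the boundary slack $\delta$.
   Context: $q$-Zeta numerator: let $P$ be a finite graded poset with a unique maximum and rank function $\rho:P\to\{0,\dots,H\}$, where $H$ is the maximal rank. For $m\ge 0$ put $A_m(P,\rho;q)=\sum_{x_1\le\cdots\le x_m}q^{\rho(x_1)+\cdots+\rho(x_m)}$ (sum over weak chains in $P$; $A_0=1$). The numerator $\mathbb{H}_{P,\rho}(q,t)$ is the polynomial determined by $\sum_{m\ge 0}A_m(P,\rho;q)t^m=\mathbb{H}_{P,\rho}(q,t)/\prod_{a=0}^{H}(1-q^at)$. Trapezoidal poset: $T_{r,s}=\{(i,c):1\le i\le r,\ i\le c\le s-i\}$, ordered by $(i,c)\le(j,d)\iff i\ge j$ and $c\le d$. Gaussian binomials: for integers $N,k$, $\genfrac{[}{]}{0pt}{}{N}{k}_q=\prod_{v=1}^{k}\frac{1-q^{N-k+v}}{1-q^v}$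 if $0\le k\le N$, and $0$ otherwise (including when $N<0$). One-boundary polynomial: for integers $a,b,e\ge0$ with $b\le a+e$, $$\Phi_{a,b}^{e}(X,q)=\sum_{\nu\ge0}X^{\nu}q^{\nu^2}\left(\genfrac{[}{]}{0pt}{}{a}{\nu}_q\genfrac{[}{]}{0pt}{}{b}{\nu}_q-q^{e}\genfrac{[}{]}{0pt}{}{b-e+1}{\nu+1}_q\genfrac{[}{]}{0pt}{}{a+e-1}{\nu-1}_q\right).$$ -}

module Defs where

open import Level using (Level; 0ℓ)
open import Algebra.Bundles using (RawRing)
import Algebra.Definitions.RawSemiring as RawSemiringDefs
open import Data.Bool.Base using (if_then_else_)
open import Data.Fin.Base using (toℕ)
open import Data.Integer.Base as ℤ using (ℤ; +_; 0ℤ; 1ℤ)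
open import Data.List.Base
  using (List; []; _∷_; map; foldr; filter; cartesianProduct; cartesianProductWith; upTo)
import Data.List.Membership.Setoid as Membership
open import Data.List.Membership.Propositional.Properties using (∈-cartesianProduct⁺; ∈-upTo⁺)
open import Data.List.Relation.Unary.All using (All; []; _∷_)
open import Data.List.Relation.Unary.Any using (here; there)
open import Data.List.Relation.Unary.AllPairs using ([]; _∷_)
open import Data.List.Relation.Unary.Linked using (linked?)
open import Data.List.Relation.Unary.Enumerates.Setoid using (IsEnumeration)
open import Data.List.Relation.Unary.Unique.Setoid using (Unique)
open import Data.List.Relation.Unary.Unique.Propositional.Properties using (cartesianProduct⁺; upTo⁺)
open import Data.Nat.Base as ℕ using (ℕ; zero; suc; _∸_; _≤_; _<_; z≤n; s≤s)
open import Data.Nat.Divisibility using (_∣?_)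
open import Data.Nat.ListAction using (sum)
import Data.Nat.Properties as ℕ
open import Data.Product.Base using (Σ; _×_; _,_; proj₁; proj₂)
open import Data.Product.Properties using (≡-dec)
open import Data.Sum.Base using (inj₁; inj₂)
open import Function.Base using (_∘_)
open import Relation.Binary using (DecPoset; Setoid; Maximum; _Respects_)
import Relation.Binary.Construct.On as On
import Relation.Binary.Construct.NonStrictToStrict as ToStrict
open import Relation.Binary.PropositionalEquality renaming (setoid to ≡-setoid)
open import Relation.Nullary using (¬_; yes; no; does; contradiction; _×-dec_)
open import Relation.Unary using (Pred; Decidable)

module Ring {c ℓ : Level} (R : RawRing c ℓ) where
  open RawRing R public
  open RawSemiringDefs rawSemiring public using () renaming (sum to ∑; product to ∏)

  infixl 6 _-_
  _-_ : Carrier → Carrier → Carrier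
  x - y = x + - y

module PowerSeries {c ℓ : Level} (R : RawRing c ℓ) where
  open Ring R

  Series : Set c
  Series = ℕ → Carrier

  var^ : ℕ → Series
  var^ n m = if does (m ℕ.≟ n) then 1# else 0#

  const : Carrier → Series
  const a zero    = a
  const a (suc _) = 0#

  -- 1 / (1 - X^v) = ∑ⱼ X^(v j), for v ≥ 1
  1/1-var^ : ℕ → Series
  1/1-var^ v m = if does (v ∣? m) then 1# else 0#

  rawRing : RawRing c ℓ
  rawRing = record
    { Carrier = Series
    ; _≈_     = λ f g → ∀ n → f n ≈ g n
    ; _+_     = λ f g n → f n + g n
    ; _*_     = λ f g n → ∑ {suc n} (λ k → f (toℕ k) * g (n ∸ toℕ k))
    ; -_      = λ f n → - f n
    ; 0#      = λ _ → 0#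
    ; 1#      = const 1#
    }

-- Polynomials in q and t, and rational functions whose denominators have
-- constant term 1, are compared in ℤ⟦q⟧⟦t⟧, into which they embed.
-- For f : ℤ⟦q⟧⟦t⟧, the coefficient of t^n q^k is f n k.

module Q  = PowerSeries ℤ.+-*-rawRing
module QT = PowerSeries Q.rawRing

ℤ⟦q⟧ ℤ⟦q⟧⟦t⟧ : Set
ℤ⟦q⟧    = Q.Series
ℤ⟦q⟧⟦t⟧ = QT.Series

infix 4 _≋_
_≋_ : ℤ⟦q⟧⟦t⟧ → ℤ⟦q⟧⟦t⟧ → Set
_≋_ = RawRing._≈_ QT.rawRing

infix 9 q^_
q^_ : ℕ → ℤ⟦q⟧
q^_ = Q.var^

-- Coefficients in increasing order of degree: the outer list is indexed by
-- powers of t, the inner ones by powers of q.  Trailing zeros are allowed, so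
-- polynomials are compared through ⟦_⟧.
ℤ[q,t] : Set
ℤ[q,t] = List (List ℤ)

coefficient : {A : Set} → A → List A → ℕ → A
coefficient z []       n       = z
coefficient z (a ∷ as) zero    = a
coefficient z (a ∷ as) (suc n) = coefficient z as n

⟦_⟧ : ℤ[q,t] → ℤ⟦q⟧⟦t⟧
⟦ h ⟧ n k = coefficient 0ℤ (coefficient [] h n) k

evaluate : ℤ[q,t] → (q t : ℤ) → ℤ
evaluate h q t = foldr (λ f rest → horner f ℤ.+ t ℤ.* rest) 0ℤ h
  where
  horner : List ℤ → ℤ
  horner = foldr (λ a rest → a ℤ.+ q ℤ.* rest) 0ℤ

module _ where
  open Ring Q.rawRing

  gaussian : ℤ → ℤ → ℤ⟦q⟧
  gaussian (+ N) (+ k) =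
    if does (k ℕ.≤? N)
    then ∏ {k} (λ i → let v = suc (toℕ i) in (1# - q^ (N ∸ k ℕ.+ v)) * Q.1/1-var^ v)
    else 0#
  gaussian _ _ = 0#

  -- Φ a b e is Φ^e_{a,b}(t,q), given by its coefficient of t^ν.  The formula is
  -- used for all a, b, e, although it is only of interest when b ≤ a + e.
  Φ : (a b e : ℕ) → ℤ⟦q⟧⟦t⟧
  Φ a b e ν =
    q^ (ν ℕ.* ν) *
      (gaussian (+ a) (+ ν) * gaussian (+ b) (+ ν)
        - q^ e * (gaussian (+ b ℤ.- + e ℤ.+ 1ℤ) (+ ν ℤ.+ 1ℤ)
                   * gaussian (+ a ℤ.+ + e ℤ.- 1ℤ) (+ ν ℤ.- 1ℤ)))

record GradedPoset : Set₁ where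
  field
    decPoset : DecPoset 0ℓ 0ℓ 0ℓ

  open DecPoset decPoset public
    using (Carrier; _≈_; _≟_; _≤?_)
    renaming ( _≤_ to _⊑_; refl to ⊑-refl; trans to ⊑-trans
             ; ≤-respˡ-≈ to ⊑-respˡ-≈; ≤-respʳ-≈ to ⊑-respʳ-≈)

  setoid : Setoid 0ℓ 0ℓ
  setoid = DecPoset.Eq.setoid decPoset

  open ToStrict _≈_ _⊑_ public using () renaming (_<_ to _⊏_)

  infix 4 _⋖_
  _⋖_ : Carrier → Carrier → Set
  x ⋖ y = x ⊏ y × (∀ z → ¬ (x ⊏ z × z ⊏ y))

  field
    elements     : List Carrier
    complete     : IsEnumeration setoid elements
    unique       : Unique setoid elements
    top          : Carrier
    top-maximum  : Maximum _⊑_ top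
    rank         : Carrier → ℕ
    rank-cong    : ∀ {x y} → x ≈ y → rank x ≡ rank y
    rank-strict  : ∀ {x y} → x ⊏ y → rank x < rank y
    rank-cover   : ∀ {x y} → x ⋖ y → rank y ≡ suc (rank x)

  rank-mono : ∀ {x y} → x ⊑ y → rank x ≤ rank y
  rank-mono {x} {y} x⊑y with x ≟ y
  ... | yes x≈y = ℕ.≤-reflexive (rank-cong x≈y)
  ... | no  x≉y = ℕ.<⇒≤ (rank-strict (x⊑y , x≉y))

  maximalRank : ℕ
  maximalRank = rank top

  rank≤maximalRank : ∀ x → rank x ≤ maximalRank
  rank≤maximalRank x = rank-mono (top-maximum x)

words : {A : Set} → ℕ → List A → List (List A)
words zero    xs = [] ∷ []
words (suc m) xs = cartesianProductWith _∷_ xs (words m xs)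

module _ (P : GradedPoset) where
  open GradedPoset P

  weakChains : ℕ → List (List Carrier)
  weakChains m = filter (linked? _≤?_) (words m elements)

  chainSeries : ℤ⟦q⟧⟦t⟧
  chainSeries m = foldr _+_ 0# (map (λ xs → q^ sum (map rank xs)) (weakChains m))
    where open Ring Q.rawRing

  -- ∑ₘ Aₘ t^m = h / ∏ₐ (1 - q^a t), with the denominator cleared.
  IsNumerator : ℤ[q,t] → Set
  IsNumerator h =
    chainSeries * ∏ {suc maximalRank} (λ a → 1# - QT.const (q^ toℕ a) * QT.var^ 1) ≋ ⟦ h ⟧
    where open Ring QT.rawRing

module Restrict (S : Setoid 0ℓ 0ℓ) {P : Pred (Setoid.Carrier S) 0ℓ} (P? : Decidable P) where
  open Setoid S using (_≈_; _≉_) renaming (Carrier to A)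
  open Membership S using (_∈_)

  sub : Setoid 0ℓ 0ℓ
  sub = On.setoid {B = Σ A P} S proj₁

  restrict : List A → List (Σ A P)
  restrict []       = []
  restrict (a ∷ as) with P? a
  ... | yes p = (a , p) ∷ restrict as
  ... | no  _ = restrict as

  restrict-complete : P Respects _≈_ → ∀ {as} → (∀ a → P a → a ∈ as) →
                      IsEnumeration sub (restrict as)
  restrict-complete resp all (a , p) = go (all a p) p
    where
    go : ∀ {as a} → a ∈ as → (p : P a) → Membership._∈_ sub (a , p) (restrict as)
    go {b ∷ as} (here a≈b) p with P? b
    ... | yes _  = here a≈b
    ... | no  ¬p = contradiction (resp a≈b p) ¬p
    go {b ∷ as} (there a∈) p with P? b
    ... | yes _  = there (go a∈ p)
    ... | no  _  = go a∈ p

  restrict-unique : ∀ {as} → Unique S as → Unique sub (restrict as)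
  restrict-unique []                 = []
  restrict-unique {a ∷ as} (px ∷ pxs) with P? a
  ... | yes _ = go px ∷ restrict-unique pxs
    where
    go : ∀ {bs} → All (a ≉_) bs → All (λ b → a ≉ proj₁ b) (restrict bs)
    go [] = []
    go {b ∷ bs} (p ∷ ps) with P? b
    ... | yes _ = p ∷ go ps
    ... | no  _ = go ps
  ... | no  _ = restrict-unique pxs

module _ (P : GradedPoset) where
  open GradedPoset P

  interval : (x y : Carrier) → x ⊑ y → GradedPoset
  interval x y x⊑y = record
    { decPoset    = On.decPoset {B = Σ Carrier In} decPoset proj₁
    ; elements    = restrict elements
    ; complete    = restrict-complete In-resp (λ z _ → complete z)
    ; unique      = restrict-unique unique
    ; top         = y , x⊑y , ⊑-refl
    ; top-maximum = λ (_ , _ , z⊑y) → z⊑y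
    ; rank        = λ (z , _) → rank z ∸ rank x
    ; rank-cong   = λ z≈w → cong (_∸ rank x) (rank-cong z≈w)
    ; rank-strict = λ {(_ , x⊑z , _)} z⊏w → ℕ.∸-monoˡ-< (rank-strict z⊏w) (rank-mono x⊑z)
    ; rank-cover  = λ {(z , x⊑z , _)} {(w , _ , w⊑y)} (z⊏w , none) →
        trans (cong (_∸ rank x) (rank-cover (z⊏w , λ v (z⊏v , v⊏w) →
                none (v , ⊑-trans x⊑z (proj₁ z⊏v) , ⊑-trans (proj₁ v⊏w) w⊑y) (z⊏v , v⊏w))))
              (ℕ.+-∸-assoc 1 (rank-mono x⊑z))
    }
    where
    In : Pred Carrier 0ℓ
    In z = x ⊑ z × z ⊑ y

    In-resp : In Respects _≈_
    In-resp z≈w (x⊑z , z⊑y) = ⊑-respʳ-≈ z≈w x⊑z , ⊑-respˡ-≈ z≈w z⊑y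

    open Restrict setoid {In} (λ z → (x ≤? z) ×-dec (z ≤? y))

plane : DecPoset 0ℓ 0ℓ 0ℓ
plane = record
  { Carrier = ℕ × ℕ
  ; _≈_     = _≡_
  ; _≤_     = λ (i , c) (j , d) → j ≤ i × c ≤ d
  ; isDecPartialOrder = record
    { isPartialOrder = record
      { isPreorder = record
        { isEquivalence = isEquivalence
        ; reflexive     = λ { refl → ℕ.≤-refl , ℕ.≤-refl }
        ; trans         = λ (j≤i , c≤d) (k≤j , d≤e) → ℕ.≤-trans k≤j j≤i , ℕ.≤-trans c≤d d≤e
        }
      ; antisym = λ (j≤i , c≤d) (i≤j , d≤c) → cong₂ _,_ (ℕ.≤-antisym i≤j j≤i) (ℕ.≤-antisym c≤d d≤c)
      }
    ; _≟_  = ≡-dec ℕ._≟_ ℕ._≟_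
    ; _≤?_ = λ (i , c) (j , d) → (j ℕ.≤? i) ×-dec (c ℕ.≤? d)
    }
  }

-- The truncated s ∸ i is exact in the trapezoidal poset, where i ≤ r ≤ s.
InTrapezoid : (r s : ℕ) → Pred (ℕ × ℕ) 0ℓ
InTrapezoid r s (i , c) = (1 ≤ i × i ≤ r) × (i ≤ c × c ≤ s ∸ i)

Cell : (r s : ℕ) → Set
Cell r s = Σ (ℕ × ℕ) (InTrapezoid r s)

row col : ∀ {r s} → Cell r s → ℕ
row ((i , _) , _) = i
col ((_ , c) , _) = c

infix 4 _⊴_
_⊴_ : ∀ {r s} → Cell r s → Cell r s → Set
x ⊴ y = row y ≤ row x × col x ≤ col y

trapezoid : (r s : ℕ) → 2 ≤ 2 ℕ.* r → 2 ℕ.* r ≤ s → GradedPoset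
trapezoid r s 2≤2r 2r≤s = record
  { decPoset    = On.decPoset {B = Cell r s} plane proj₁
  ; elements    = restrict box
  ; complete    = restrict-complete (λ { refl p → p }) box-complete
  ; unique      = restrict-unique (cartesianProduct⁺ (upTo⁺ (suc r)) (upTo⁺ (suc s)))
  ; top         = (1 , s ∸ 1) , (ℕ.≤-refl , 1≤r) , (ℕ.∸-monoˡ-≤ 1 (ℕ.≤-trans 2≤2r 2r≤s) , ℕ.≤-refl)
  ; top-maximum = λ (_ , (1≤i , _) , (_ , c≤s∸i)) →
                    1≤i , ℕ.≤-trans c≤s∸i (ℕ.∸-monoʳ-≤ s 1≤i)
  ; rank        = λ z → col z ∸ row z
  ; rank-cong   = λ { refl → refl }
  ; rank-strict = λ {z} {w} → strict z w
  ; rank-cover  = λ {z} {w} → cover z w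
  }
  where
  open Restrict (≡-setoid (ℕ × ℕ)) {InTrapezoid r s}
    (λ (i , c) → ((1 ℕ.≤? i) ×-dec (i ℕ.≤? r)) ×-dec ((i ℕ.≤? c) ×-dec (c ℕ.≤? s ∸ i)))

  open ToStrict {A = Cell r s} (λ z w → proj₁ z ≡ proj₁ w) _⊴_ using () renaming (_<_ to _⊏_)

  1≤r : 1 ≤ r
  1≤r = ℕ.*-cancelˡ-≤ 2 2≤2r

  box : List (ℕ × ℕ)
  box = cartesianProduct (upTo (suc r)) (upTo (suc s))

  box-complete : ∀ p → InTrapezoid r s p → Membership._∈_ (≡-setoid (ℕ × ℕ)) p box
  box-complete (i , c) ((_ , i≤r) , (_ , c≤s∸i)) =
    ∈-cartesianProduct⁺ (∈-upTo⁺ (s≤s i≤r)) (∈-upTo⁺ (s≤s (ℕ.≤-trans c≤s∸i (ℕ.m∸n≤m s i))))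

  strict : (z w : Cell r s) → z ⊏ w → col z ∸ row z < col w ∸ row w
  strict ((i , c) , _ , (i≤c , _)) ((j , d) , _) ((j≤i , c≤d) , z≢w) with ℕ.m≤n⇒m<n∨m≡n c≤d
  ... | inj₁ c<d  = ℕ.<-≤-trans (ℕ.∸-monoˡ-< c<d i≤c) (ℕ.∸-monoʳ-≤ d j≤i)
  ... | inj₂ refl = ℕ.∸-monoʳ-< (ℕ.≤∧≢⇒< j≤i (λ { refl → z≢w refl })) i≤c

  cover : (z w : Cell r s) → z ⊏ w × (∀ v → ¬ (z ⊏ v × v ⊏ w)) → col w ∸ row w ≡ suc (col z ∸ row z)
  cover z@((i , c) , (1≤i , i≤r) , (i≤c , c≤s∸i)) w@((j , d) , (1≤j , _) , (_ , d≤s∸j))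
        (((j≤i , c≤d) , z≢w) , none) with ℕ.m≤n⇒m<n∨m≡n j≤i
  ... | inj₁ (s≤s {n = k} j≤k) with ≡-dec ℕ._≟_ ℕ._≟_ (k , c) (j , d)
  ...   | yes refl = ℕ.+-∸-assoc 1 i≤c
  ...   | no  v≢w  = contradiction
          ( ((ℕ.n≤1+n k , ℕ.≤-refl) , λ e → ℕ.1+n≢n (cong proj₁ e))
          , ((j≤k , c≤d) , v≢w) )
          (none ((k , c) , (ℕ.≤-trans 1≤j j≤k , ℕ.<⇒≤ i≤r)
                         , (ℕ.<⇒≤ i≤c , ℕ.≤-trans c≤s∸i (ℕ.∸-monoʳ-≤ s (ℕ.n≤1+n k)))))
  cover z@((i , c) , 1≤i≤r , (i≤c , c≤s∸i)) w@((j , d) , _ , (_ , d≤s∸j))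
        (((j≤i , c≤d) , z≢w) , none) | inj₂ refl with ≡-dec ℕ._≟_ ℕ._≟_ (i , suc c) (j , d)
  ...   | yes refl = ℕ.+-∸-assoc 1 i≤c
  ...   | no  v≢w  = contradiction
          ( ((ℕ.≤-refl , ℕ.n≤1+n c) , λ e → ℕ.1+n≢n (sym (cong proj₂ e)))
          , ((ℕ.≤-refl , c<d) , v≢w) )
          (none ((i , suc c) , 1≤i≤r , (ℕ.m≤n⇒m≤1+n i≤c , ℕ.≤-trans c<d d≤s∸j)))
    where
    c<d : c < d
    c<d = ℕ.≤∧≢⇒< c≤d (λ { refl → z≢w refl })

{-# OPTIONS --safe #-}

-- Let F_z(t) be the generating function of the weak chains below z.  Removing the
-- possible last element z, and inclusion-exclusion over the lower covers of z, give
-- F_z (1 - q^ρ(z) t) = F_z₁ + F_z₂ - F_{z₁∧z₂} (two covers) or = F_z₁ (one cover).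
-- Place z at (a , b) = (row x - row z , col z - col x).  The interval is the region
-- 0 ≤ a ≤ ℓ, 0 ≤ b ≤ u, b ≤ a + δ, in which (a , b) has a single cover exactly on the
-- two axes and on the line b = a + δ.  So the numerators satisfy
--   N(a+1,b+1) + N(a,b) = N(a,b+1) + N(a+1,b) + q^(a+b+1) t N(a,b)   if b < a + δ,
--   N(a+1,a+1+δ) = N(a+1,a+δ),   N(0,b) = N(a,0) = 1,
-- and this determines them.  By the q-Pascal rule Φ satisfies the same recursion: each
-- of the two products of Gaussian binomials in it has the factorized mixed difference
-- that the first line asks for, and on the line b = a + δ their increments cancel.
-- At q = t = 1 the recursion is the one for ballot numbers.
module Submission where

open import Defs
open import Algebra.Bundles using (CommutativeRing)
import Algebra.Properties.AbelianGroup as AbelianGroupProperties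
import Algebra.Properties.CommutativeSemigroup as CommutativeSemigroupProperties
import Algebra.Properties.Ring as RingProperties
import Algebra.Solver.Ring.NaturalCoefficients.Default as SemiringSolver
open import Data.Bool.Base using (Bool; true; false; _∧_; if_then_else_)
open import Data.Fin.Base using (toℕ)
open import Data.Integer as ℤ using (ℤ; +_; 0ℤ; 1ℤ)
import Data.Integer.Properties as ℤ
open import Data.Integer.Tactic.RingSolver using (solve-∀)
open import Data.List.Base
  using (List; []; _∷_; _++_; map; foldr; filter; replicate; cartesianProductWith)
import Data.List.Membership.Setoid as Membership
open import Data.List.Properties using (++-identityʳ)
open import Data.List.Relation.Unary.All as All using (All; []; _∷_)
open import Data.List.Relation.Unary.AllPairs using ([]; _∷_)
open import Data.List.Relation.Unary.Any using (here; there)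
open import Data.List.Relation.Unary.Linked using (linked?)
open import Data.List.Relation.Unary.Unique.Setoid using (Unique)
open import Data.Nat using (ℕ; zero; suc; _+_; _*_; _∸_; _≤_; _<_; z≤n; s≤s; NonZero; >-nonZero)
open import Data.Nat.Combinatorics
  using (_C_; nCk+nC[k+1]≡[n+1]C[k+1]; nCk≡nC[n∸k]; nCn≡1; k>n⇒nCk≡0)
open import Data.Nat.Divisibility using (_∣?_; ∣m+n∣m⇒∣n; ∣m∣n⇒∣m+n; ∣-refl; >⇒∤)
open import Data.Nat.ListAction using (sum)
import Data.Nat.Properties as ℕ
open import Data.Nat.Solver using (module +-*-Solver)
open import Data.Product using (∃; _×_; _,_; proj₁; proj₂)
open import Data.Sum.Base using (_⊎_; inj₁; inj₂)
open import Function.Base using (_∘_; id)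
open import Function.Bundles using (mk⇔)
open import Level using (Level; 0ℓ; _⊔_)
open import Relation.Binary using (Rel; Setoid; DecPoset) renaming (Decidable to Decidable₂)
open import Relation.Binary.PropositionalEquality as ≡ using (_≡_)
open import Relation.Nullary using (¬_; does; yes; no; contradiction)
open import Relation.Nullary.Decidable using (does-⇔; dec-true; dec-false)
open import Relation.Unary using (Pred; Decidable)

private module NS = +-*-Solver

-- The term q^(a+b+1) t N(a,b) is a trace of the denominators: that of z₁∧z₂ ends two factors before
-- that of z, so multiplying its series by the denominator of the covers leaves an extra factor 1 -
-- q^(a+b+1) t. The subtracted product in Φ is a reflected copy of the first one. By Vandermonde it
-- sums at q = t = 1 to C(a+b, a+δ+1), the number of lattice paths to the mirror image of (a , b) in
-- the line b = a + δ + 1. Its upper indices again add up to a + b and its lower indices to 2ν, so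
-- both products obey the same recursion separately; only the line b = a + δ ties them together. Two
-- obstacles shape the rest. Chains are enumerated from their first element, while the recursion
-- removes the last one. And a power series cannot be evaluated at q = 1, so the recursion runs a
-- second time on coefficient lists; this gives a polynomial numerator together with its value, and
-- the value is the same for all lists with the same coefficients.

if-true : ∀ {a} {A : Set a} {b} {x y : A} → b ≡ true → (if b then x else y) ≡ x
if-true ≡.refl = ≡.refl

if-false : ∀ {a} {A : Set a} {b} {x y : A} → b ≡ false → (if b then x else y) ≡ y
if-false ≡.refl = ≡.refl

-- Formal power series

module PowerSeriesProperties {c ℓ : Level} (R : CommutativeRing c ℓ) where
  open CommutativeRing R
    hiding (zero; rawRing)
    renaming (_+_ to _⊕_; _*_ to _⊗_; -_ to ⊖_)
  open PowerSeries (CommutativeRing.rawRing R)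
  open Ring rawRing using () renaming (_+_ to _⊞_; _*_ to _⊠_; -_ to ⊟_; _≈_ to _≋ₛ_; 0# to 0ₛ; 1# to 1ₛ) public
  open CommutativeSemigroupProperties +-commutativeSemigroup using (interchange; x∙yz≈y∙xz)
  open RingProperties ring using (-0#≈0#)
  open import Relation.Binary.Reasoning.Setoid setoid

  ⊠-cong : ∀ {f f′ g g′} → f ≋ₛ f′ → g ≋ₛ g′ → f ⊠ g ≋ₛ f′ ⊠ g′
  ⊠-cong f≋ g≋ zero    = +-congʳ (*-cong (f≋ 0) (g≋ 0))
  ⊠-cong f≋ g≋ (suc n) = +-cong (*-cong (f≋ 0) (g≋ (suc n))) (⊠-cong (f≋ ∘ suc) g≋ n)

  ⊠-zeroˡ : ∀ g → 0ₛ ⊠ g ≋ₛ 0ₛ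
  ⊠-zeroˡ g zero    = trans (+-identityʳ _) (zeroˡ _)
  ⊠-zeroˡ g (suc n) = trans (+-cong (zeroˡ _) (⊠-zeroˡ g n)) (+-identityʳ 0#)

  const-⊠ : ∀ a g → const a ⊠ g ≋ₛ (λ n → a ⊗ g n)
  const-⊠ a g zero    = +-identityʳ _
  const-⊠ a g (suc n) = trans (+-congˡ (⊠-zeroˡ g n)) (+-identityʳ _)

  ⊠-distribʳ : ∀ h f g → (f ⊞ g) ⊠ h ≋ₛ f ⊠ h ⊞ g ⊠ h
  ⊠-distribʳ h f g zero    = trans (+-cong (distribʳ _ _ _) (sym (+-identityʳ 0#))) (interchange _ _ _ _)
  ⊠-distribʳ h f g (suc n) = trans (+-cong (distribʳ _ _ _) (⊠-distribʳ h (f ∘ suc) (g ∘ suc) n)) (interchange _ _ _ _)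

  -- The product unfolds by splitting off the constant term of the left factor. Splitting off that
  -- of the right factor instead is what commutativity needs.
  ⊠-last : ∀ f g n → (f ⊠ g) (suc n) ≈ f (suc n) ⊗ g 0 ⊕ (f ⊠ (g ∘ suc)) n
  ⊠-last f g zero    = begin
    f 0 ⊗ g 1 ⊕ (f 1 ⊗ g 0 ⊕ 0#)  ≈⟨ x∙yz≈y∙xz _ _ _ ⟩
    f 1 ⊗ g 0 ⊕ (f 0 ⊗ g 1 ⊕ 0#)  ∎
  ⊠-last f g (suc n) = begin
    f 0 ⊗ g (suc (suc n)) ⊕ ((f ∘ suc) ⊠ g) (suc n)
      ≈⟨ +-congˡ (⊠-last (f ∘ suc) g n) ⟩
    f 0 ⊗ g (suc (suc n)) ⊕ (f (suc (suc n)) ⊗ g 0 ⊕ ((f ∘ suc) ⊠ (g ∘ suc)) n)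
      ≈⟨ x∙yz≈y∙xz _ _ _ ⟩
    f (suc (suc n)) ⊗ g 0 ⊕ (f 0 ⊗ g (suc (suc n)) ⊕ ((f ∘ suc) ⊠ (g ∘ suc)) n) ∎

  ⊠-comm : ∀ f g → f ⊠ g ≋ₛ g ⊠ f
  ⊠-comm f g zero    = +-congʳ (*-comm _ _)
  ⊠-comm f g (suc n) = begin
    f 0 ⊗ g (suc n) ⊕ ((f ∘ suc) ⊠ g) n  ≈⟨ +-cong (*-comm _ _) (⊠-comm (f ∘ suc) g n) ⟩
    g (suc n) ⊗ f 0 ⊕ (g ⊠ (f ∘ suc)) n  ≈⟨ ⊠-last g f n ⟨
    (g ⊠ f) (suc n)                      ∎

  ⊠-scaleˡ : ∀ a f g → (λ n → a ⊗ f n) ⊠ g ≋ₛ (λ n → a ⊗ (f ⊠ g) n)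
  ⊠-scaleˡ a f g zero    = trans (+-cong (*-assoc _ _ _) (sym (zeroʳ a))) (sym (distribˡ _ _ _))
  ⊠-scaleˡ a f g (suc n) = trans (+-cong (*-assoc _ _ _) (⊠-scaleˡ a (f ∘ suc) g n)) (sym (distribˡ _ _ _))

  ⊠-assoc : ∀ f g h → (f ⊠ g) ⊠ h ≋ₛ f ⊠ (g ⊠ h)
  ⊠-assoc f g h zero    = +-congʳ (begin
    (f 0 ⊗ g 0 ⊕ 0#) ⊗ h 0  ≈⟨ *-congʳ (+-identityʳ _) ⟩
    (f 0 ⊗ g 0) ⊗ h 0       ≈⟨ *-assoc _ _ _ ⟩
    f 0 ⊗ (g 0 ⊗ h 0)       ≈⟨ *-congˡ (+-identityʳ _) ⟨
    f 0 ⊗ (g 0 ⊗ h 0 ⊕ 0#)  ∎)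
  ⊠-assoc f g h (suc n) = begin
    -- By definition the tail of `f ⊠ g` is `(λ m → f 0 ⊗ g (suc m)) ⊞ (f ∘ suc) ⊠ g`, so the
    -- induction runs on the tail of `f`.
    (f 0 ⊗ g 0 ⊕ 0#) ⊗ h (suc n) ⊕ (((λ m → f 0 ⊗ g (suc m)) ⊞ (f ∘ suc) ⊠ g) ⊠ h) n
      ≈⟨ +-cong (trans (*-congʳ (+-identityʳ _)) (*-assoc _ _ _))
                (trans (⊠-distribʳ h (λ m → f 0 ⊗ g (suc m)) ((f ∘ suc) ⊠ g) n)
                       (+-cong (⊠-scaleˡ (f 0) (g ∘ suc) h n) (⊠-assoc (f ∘ suc) g h n))) ⟩
    f 0 ⊗ (g 0 ⊗ h (suc n)) ⊕ (f 0 ⊗ ((g ∘ suc) ⊠ h) n ⊕ ((f ∘ suc) ⊠ (g ⊠ h)) n)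
      ≈⟨ +-assoc _ _ _ ⟨
    f 0 ⊗ (g 0 ⊗ h (suc n)) ⊕ f 0 ⊗ ((g ∘ suc) ⊠ h) n ⊕ ((f ∘ suc) ⊠ (g ⊠ h)) n
      ≈⟨ +-congʳ (distribˡ _ _ _) ⟨
    f 0 ⊗ (g ⊠ h) (suc n) ⊕ ((f ∘ suc) ⊠ (g ⊠ h)) n ∎

  ⊠-identityˡ : ∀ g → 1ₛ ⊠ g ≋ₛ g
  ⊠-identityˡ g n = trans (const-⊠ 1# g n) (*-identityˡ _)

  commutativeRing : CommutativeRing c ℓ
  commutativeRing = record
    { Carrier = Series
    ; isCommutativeRing = record
      { isRing = record
        { +-isAbelianGroup = record
          { isGroup = record
            { isMonoid = record
              { isSemigroup = record
                { isMagma = record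
                  { isEquivalence = record
                    { refl  = λ n → refl
                    ; sym   = λ p n → sym (p n)
                    ; trans = λ p q n → trans (p n) (q n)
                    }
                  ; ∙-cong = λ p q n → +-cong (p n) (q n)
                  }
                ; assoc = λ f g h n → +-assoc _ _ _
                }
              ; identity = (λ f n → +-identityˡ _) , (λ f n → +-identityʳ _)
              }
            ; inverse = (λ f n → -‿inverseˡ _) , (λ f n → -‿inverseʳ _)
            ; ⁻¹-cong = λ p n → -‿cong (p n)
            }
          ; comm = λ f g n → +-comm _ _
          }
        ; *-cong     = ⊠-cong
        ; *-assoc    = ⊠-assoc
        ; *-identity = ⊠-identityˡ , (λ f n → trans (⊠-comm f 1ₛ n) (⊠-identityˡ f n))
        ; distrib    = (λ f g h n → trans (⊠-comm f (g ⊞ h) n)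
                          (trans (⊠-distribʳ f g h n) (+-cong (⊠-comm g f n) (⊠-comm h f n))))
                     , ⊠-distribʳ
        }
      ; *-comm = ⊠-comm
      }
    }

  var^-zero : var^ 0 ≋ₛ 1ₛ
  var^-zero zero    = refl
  var^-zero (suc n) = refl

  var^suc-⊠-zero : ∀ n g → (var^ (suc n) ⊠ g) 0 ≈ 0#
  var^suc-⊠-zero n g = trans (+-identityʳ _) (zeroˡ _)

  var^suc-⊠-suc : ∀ n g m → (var^ (suc n) ⊠ g) (suc m) ≈ (var^ n ⊠ g) m
  var^suc-⊠-suc n g m = trans (+-congʳ (zeroˡ _)) (+-identityˡ _)

  var^0-⊠ : ∀ g → var^ 0 ⊠ g ≋ₛ g
  var^0-⊠ g n = trans (⊠-cong {g = g} var^-zero (λ _ → refl) n) (⊠-identityˡ g n)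

  var^-+ : ∀ m n → var^ m ⊠ var^ n ≋ₛ var^ (m + n)
  var^-+ zero    n k       = var^0-⊠ (var^ n) k
  var^-+ (suc m) n zero    = var^suc-⊠-zero m (var^ n)
  var^-+ (suc m) n (suc k) = trans (var^suc-⊠-suc m (var^ n) k) (var^-+ m n k)

  var^-⊠-shift : ∀ v g m → (var^ v ⊠ g) (v + m) ≈ g m
  var^-⊠-shift zero    g m = var^0-⊠ g m
  var^-⊠-shift (suc v) g m = trans (var^suc-⊠-suc v g (v + m)) (var^-⊠-shift v g m)

  var^-⊠-below : ∀ {v m} g → m < v → (var^ v ⊠ g) m ≈ 0#
  var^-⊠-below {suc v} {zero}  g _         = var^suc-⊠-zero v g
  var^-⊠-below {suc v} {suc m} g (s≤s m<v) = trans (var^suc-⊠-suc v g m) (var^-⊠-below g m<v)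

  -- The coefficients of the geometric series have period `suc v`, so from that degree on the
  -- shifted copy cancels them. Below it there is no shifted copy, and only the coefficient in
  -- degree 0 is nonzero.
  1/1-var^-inverse : ∀ v → (1ₛ ⊞ ⊟ var^ (suc v)) ⊠ 1/1-var^ (suc v) ≋ₛ 1ₛ
  1/1-var^-inverse v n = begin
    ((1ₛ ⊞ ⊟ var^ (suc v)) ⊠ I) n      ≈⟨ ⊠-distribʳ I 1ₛ (⊟ var^ (suc v)) n ⟩
    (1ₛ ⊠ I) n ⊕ (⊟ var^ (suc v) ⊠ I) n ≈⟨ +-cong (⊠-identityˡ I n) (sym (SeriesRing.-‿distribˡ-* (var^ (suc v)) I n)) ⟩
    I n ⊕ ⊖ (var^ (suc v) ⊠ I) n       ≈⟨ coefficients (ℕ.≤-<-connex (suc v) n) ⟩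
    1ₛ n ∎
    where
    module SeriesRing = RingProperties (CommutativeRing.ring commutativeRing)
    I : Series
    I = 1/1-var^ (suc v)
    coefficients : ∀ {n} → suc v ≤ n ⊎ n < suc v → I n ⊕ ⊖ (var^ (suc v) ⊠ I) n ≈ 1ₛ n
    coefficients {n} (inj₁ v<n) with ℕ.m≤n⇒∃[o]m+o≡n v<n
    ... | m , ≡.refl = begin
      I (suc v + m) ⊕ ⊖ (var^ (suc v) ⊠ I) (suc v + m) ≈⟨ +-congˡ (-‿cong (var^-⊠-shift (suc v) I m)) ⟩
      I (suc v + m) ⊕ ⊖ I m                            ≡⟨ ≡.cong (λ b → (if b then 1# else 0#) ⊕ ⊖ I m) periodic ⟩
      I m ⊕ ⊖ I m                                      ≈⟨ -‿inverseʳ (I m) ⟩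
      0# ∎
      where
      periodic : does (suc v ∣? suc v + m) ≡ does (suc v ∣? m)
      periodic = does-⇔ (mk⇔ (λ d → ∣m+n∣m⇒∣n d ∣-refl) (∣m∣n⇒∣m+n ∣-refl)) (suc v ∣? suc v + m) (suc v ∣? m)
    coefficients {zero}  (inj₂ _)   = begin
      I 0 ⊕ ⊖ (var^ (suc v) ⊠ I) 0 ≈⟨ +-congˡ (-‿cong (var^-⊠-below {suc v} I (s≤s z≤n))) ⟩
      I 0 ⊕ ⊖ 0#                   ≈⟨ +-congˡ -0#≈0# ⟩
      I 0 ⊕ 0#                     ≈⟨ +-identityʳ _ ⟩
      1# ∎
    coefficients {suc n} (inj₂ n<v) = begin
      I (suc n) ⊕ ⊖ (var^ (suc v) ⊠ I) (suc n) ≈⟨ +-congˡ (-‿cong (var^-⊠-below I n<v)) ⟩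
      I (suc n) ⊕ ⊖ 0#                         ≈⟨ +-congˡ -0#≈0# ⟩
      I (suc n) ⊕ 0#                           ≈⟨ +-identityʳ _ ⟩
      I (suc n)                                ≡⟨ if-false (dec-false (suc v ∣? suc n) (>⇒∤ n<v)) ⟩
      0# ∎

-- Gaussian binomials and the recursion of Φ

module Products {c ℓ : Level} (R : CommutativeRing c ℓ) where
  open CommutativeRing R hiding (zero; rawRing) renaming (_+_ to _⊕_; _*_ to _⊗_)
  open Ring (CommutativeRing.rawRing R) using (∏)
  open SemiringSolver commutativeSemiring using (solve; _:*_; _:=_)

  Π : ℕ → (ℕ → Carrier) → Carrier
  Π n f = ∏ {n} (λ i → f (toℕ i))

  Π-cong : ∀ n {f g} → (∀ i → f i ≈ g i) → Π n f ≈ Π n g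
  Π-cong zero    f≈g = refl
  Π-cong (suc n) f≈g = *-cong (f≈g 0) (Π-cong n (f≈g ∘ suc))

  Π-last : ∀ n f → Π (suc n) f ≈ Π n f ⊗ f n
  Π-last zero    f = *-comm _ _
  Π-last (suc n) f = trans (*-congˡ (Π-last n (f ∘ suc))) (sym (*-assoc _ _ _))

  Π-⊗ : ∀ n f g → Π n (λ i → f i ⊗ g i) ≈ Π n f ⊗ Π n g
  Π-⊗ zero    f g = sym (*-identityˡ 1#)
  Π-⊗ (suc n) f g = trans (*-congˡ (Π-⊗ n (f ∘ suc) (g ∘ suc)))
    (solve 4 (λ a b x y → (a :* b) :* (x :* y) := (a :* x) :* (b :* y)) refl _ _ _ _)

-- All that the Gaussian binomials and the chain series use of q; the ring stays abstract until it
-- becomes `ℤ⟦q⟧`.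
record QPowers {c ℓ : Level} (R : CommutativeRing c ℓ) : Set (c ⊔ ℓ) where
  open CommutativeRing R using (Carrier; _≈_; 1#) renaming (_*_ to _⊗_; _-_ to _⊝_)
  field
    Q^_            : ℕ → Carrier
    1/1-Q^_        : ℕ → Carrier
    q^-zero        : Q^ 0 ≈ 1#
    q^-+           : ∀ m n → Q^ m ⊗ Q^ n ≈ Q^ (m + n)
    1/1-q^-inverse : ∀ v → (1# ⊝ Q^ (suc v)) ⊗ 1/1-Q^ (suc v) ≈ 1#

module GaussianPolynomials {c ℓ : Level} (R : CommutativeRing c ℓ) (powers : QPowers R) where
  open CommutativeRing R hiding (zero; rawRing) renaming (_+_ to _⊕_; _*_ to _⊗_; -_ to ⊖_; _-_ to _⊝_)
  open QPowers powers
  open Ring (CommutativeRing.rawRing R) using (∏)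
  open Products R
  open RingProperties ring using (-0#≈0#; -‿distribʳ-*)
  open AbelianGroupProperties +-abelianGroup using (⁻¹-∙-comm)
  open CommutativeSemigroupProperties +-commutativeSemigroup using (interchange)
  open SemiringSolver commutativeSemiring using (solve; _:+_; _:*_; _:=_)
  open import Relation.Binary.Reasoning.Setoid setoid

  q^-cong : ∀ {m n} → m ≡ n → Q^ m ≈ Q^ n
  q^-cong ≡.refl = refl

  -- Written like `gaussian` at nonnegative arguments, so that over `ℤ⟦q⟧` the two agree by
  -- definition.
  G : ℕ → ℕ → Carrier
  G N k = if does (k ℕ.≤? N)
    then ∏ {k} (λ i → let v = suc (toℕ i) in (1# ⊝ Q^ (N ∸ k + v)) ⊗ 1/1-Q^ v)
    else 0#

  numerator : ℕ → ℕ → Carrier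
  numerator M k = Π k (λ i → 1# ⊝ Q^ (M + suc i))

  denominator⁻¹ : ℕ → Carrier
  denominator⁻¹ k = Π k (λ i → 1/1-Q^ (suc i))

  G-zero : ∀ {N k} → N < k → G N k ≡ 0#
  G-zero {N} {k} N<k = if-false (dec-false (k ℕ.≤? N) (ℕ.<⇒≱ N<k))

  G-fraction : ∀ M k → G (M + k) k ≈ numerator M k ⊗ denominator⁻¹ k
  G-fraction M k = begin
    G (M + k) k
      ≡⟨ if-true (dec-true (k ℕ.≤? M + k) (ℕ.m≤n+m k M)) ⟩
    Π k (λ i → (1# ⊝ Q^ (M + k ∸ k + suc i)) ⊗ 1/1-Q^ (suc i))
      ≡⟨ ≡.cong (λ N → Π k (λ i → (1# ⊝ Q^ (N + suc i)) ⊗ 1/1-Q^ (suc i))) (ℕ.m+n∸n≡m M k) ⟩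
    Π k (λ i → (1# ⊝ Q^ (M + suc i)) ⊗ 1/1-Q^ (suc i))
      ≈⟨ Π-⊗ k (λ i → 1# ⊝ Q^ (M + suc i)) (λ i → 1/1-Q^ (suc i)) ⟩
    numerator M k ⊗ denominator⁻¹ k ∎

  numerator-first : ∀ M k → numerator M (suc k) ≈ (1# ⊝ Q^ (suc M)) ⊗ numerator (suc M) k
  numerator-first M k = *-cong (+-congˡ (-‿cong (q^-cong (ℕ.+-comm M 1))))
    (Π-cong k (λ i → +-congˡ (-‿cong (q^-cong (ℕ.+-suc M (suc i))))))

  -- The factor `1# ⊝ Q^ M` vanishes at `M = 0`, exactly where the lower index exceeds the upper
  -- one, so one formula covers both cases.
  G-fraction-suc : ∀ M k → G (M + k) (suc k) ≈ ((1# ⊝ Q^ M) ⊗ numerator M k) ⊗ denominator⁻¹ (suc k)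
  G-fraction-suc zero    k = begin
    G k (suc k)                                        ≡⟨ G-zero (ℕ.n<1+n k) ⟩
    0#                                                 ≈⟨ zeroˡ _ ⟨
    0# ⊗ denominator⁻¹ (suc k)                          ≈⟨ *-congʳ (zeroˡ _) ⟨
    (0# ⊗ numerator 0 k) ⊗ denominator⁻¹ (suc k)        ≈⟨ *-congʳ (*-congʳ (trans (+-congˡ (-‿cong q^-zero)) (-‿inverseʳ 1#))) ⟨
    ((1# ⊝ Q^ 0) ⊗ numerator 0 k) ⊗ denominator⁻¹ (suc k) ∎
  G-fraction-suc (suc M) k = begin
    G (suc M + k) (suc k)                          ≡⟨ ≡.cong (λ N → G N (suc k)) (ℕ.+-suc M k) ⟨
    G (M + suc k) (suc k)                          ≈⟨ G-fraction M (suc k) ⟩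
    numerator M (suc k) ⊗ denominator⁻¹ (suc k)     ≈⟨ *-congʳ (numerator-first M k) ⟩
    ((1# ⊝ Q^ (suc M)) ⊗ numerator (suc M) k) ⊗ denominator⁻¹ (suc k) ∎

  1-q^-split : ∀ m n → 1# ⊝ Q^ (m + n) ≈ (1# ⊝ Q^ m) ⊕ Q^ m ⊗ (1# ⊝ Q^ n)
  1-q^-split m n = sym (begin
    (1# ⊝ Q^ m) ⊕ Q^ m ⊗ (1# ⊝ Q^ n)
      ≈⟨ +-congˡ (distribˡ _ _ _) ⟩
    (1# ⊝ Q^ m) ⊕ (Q^ m ⊗ 1# ⊕ Q^ m ⊗ ⊖ Q^ n)
      ≈⟨ +-congˡ (+-cong (*-identityʳ _) (trans (sym (-‿distribʳ-* _ _)) (-‿cong (q^-+ m n)))) ⟩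
    (1# ⊕ ⊖ Q^ m) ⊕ (Q^ m ⊕ ⊖ Q^ (m + n))
      ≈⟨ +-assoc _ _ _ ⟩
    1# ⊕ (⊖ Q^ m ⊕ (Q^ m ⊕ ⊖ Q^ (m + n)))
      ≈⟨ +-congˡ (trans (sym (+-assoc _ _ _)) (trans (+-congʳ (-‿inverseˡ _)) (+-identityˡ _))) ⟩
    1# ⊝ Q^ (m + n) ∎)

  Δ : ℕ → ℕ → Carrier
  Δ N zero    = 0#
  Δ N (suc k) = Q^ (N ∸ k) ⊗ G N k

  -- With N = M + k, the last numerator factor splits as 1 - q^(M+k+1) = (1 - q^M) + q^M (1 -
  -- q^(k+1)). The first part gives [N, k+1]; in the second, 1 - q^(k+1) cancels the last factor of
  -- the denominator.
  G-pascal : ∀ N k → G (suc N) k ≈ G N k ⊕ Δ N k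
  G-pascal N zero    = sym (+-identityʳ 1#)
  G-pascal N (suc k) with ℕ.≤-<-connex k N
  ... | inj₂ N<k = begin
    G (suc N) (suc k)                  ≡⟨ G-zero (s≤s N<k) ⟩
    0#                                 ≈⟨ trans (+-identityˡ _) (zeroʳ _) ⟨
    0# ⊕ Q^ (N ∸ k) ⊗ 0#                ≡⟨ ≡.cong₂ (λ x y → x ⊕ Q^ (N ∸ k) ⊗ y) (G-zero (ℕ.m<n⇒m<1+n N<k)) (G-zero N<k) ⟨
    G N (suc k) ⊕ Q^ (N ∸ k) ⊗ G N k    ∎
  ... | inj₁ k≤N = ≡.subst (λ N → G (suc N) (suc k) ≈ G N (suc k) ⊕ Q^ (N ∸ k) ⊗ G N k)
                           (ℕ.m∸n+n≡m k≤N) (step (N ∸ k))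
    where
    step : ∀ M → G (suc (M + k)) (suc k) ≈ G (M + k) (suc k) ⊕ Q^ (M + k ∸ k) ⊗ G (M + k) k
    step M = begin
      G (suc (M + k)) (suc k)
        ≡⟨ ≡.cong (λ N → G N (suc k)) (ℕ.+-suc M k) ⟨
      G (M + suc k) (suc k)
        ≈⟨ G-fraction M (suc k) ⟩
      numerator M (suc k) ⊗ denominator⁻¹ (suc k)
        ≈⟨ *-cong (Π-last k (λ i → 1# ⊝ Q^ (M + suc i))) (Π-last k (1/1-Q^_ ∘ suc)) ⟩
      (n ⊗ (1# ⊝ Q^ (M + suc k))) ⊗ (d ⊗ i)
        ≈⟨ *-congʳ (*-congˡ (1-q^-split M (suc k))) ⟩
      (n ⊗ ((1# ⊝ Q^ M) ⊕ Q^ M ⊗ (1# ⊝ Q^ (suc k)))) ⊗ (d ⊗ i)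
        ≈⟨ solve 6 (λ n y p w d i → (n :* (y :+ p :* w)) :* (d :* i)
                                  := (y :* n) :* (d :* i) :+ p :* ((n :* d) :* (w :* i)))
             refl n (1# ⊝ Q^ M) (Q^ M) (1# ⊝ Q^ (suc k)) d i ⟩
      ((1# ⊝ Q^ M) ⊗ n) ⊗ (d ⊗ i) ⊕ Q^ M ⊗ ((n ⊗ d) ⊗ ((1# ⊝ Q^ (suc k)) ⊗ i))
        ≈⟨ +-cong (*-congˡ (sym (Π-last k (1/1-Q^_ ∘ suc))))
                  (*-cong (q^-cong (≡.sym (ℕ.m+n∸n≡m M k)))
                          (trans (*-congˡ (1/1-q^-inverse k)) (trans (*-identityʳ _) (sym (G-fraction M k))))) ⟩
      ((1# ⊝ Q^ M) ⊗ n) ⊗ denominator⁻¹ (suc k) ⊕ Q^ (M + k ∸ k) ⊗ G (M + k) k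
        ≈⟨ +-congʳ (G-fraction-suc M k) ⟨
      G (M + k) (suc k) ⊕ Q^ (M + k ∸ k) ⊗ G (M + k) k ∎
      where
      n d i : Carrier
      n = numerator M k
      d = denominator⁻¹ k
      i = 1/1-Q^ (suc k)

  module OneBoundary (e : ℕ) where

    -- The factors of the subtracted term, [b-e+1, ν+1] and [a+e-1, ν-1].  Truncation
    -- in the first one is harmless, as [0, ν+1] vanishes; in the second one it
    -- matters only for a = e = 0, where the first one vanishes if b = 0 and ν ≥ 1.
    S C : ℕ → ℕ → Carrier
    S b ν       = G (suc b ∸ e) (suc ν)
    C a zero    = 0#
    C a (suc k) = G (a + e ∸ 1) k

    free reflected φ : ℕ → ℕ → ℕ → Carrier
    free      a b ν = Q^ (ν * ν) ⊗ (G a ν ⊗ G b ν)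
    reflected a b ν = (Q^ (ν * ν) ⊗ Q^ e) ⊗ (C a ν ⊗ S b ν)
    φ         a b ν = free a b ν ⊝ reflected a b ν

    -- Multiplication by q^n t, on the sequence of coefficients of powers of t.
    shift : ℕ → (ℕ → Carrier) → ℕ → Carrier
    shift n f zero    = 0#
    shift n f (suc k) = Q^ n ⊗ f k

    -- The mixed second difference of a product is the product of the increments. All terms are
    -- moved to the side where they are positive, which lets a semiring solver prove it.
    bilinear : ∀ {z s A A′ B B′ α β} → A′ ≈ A ⊕ α → B′ ≈ B ⊕ β → z ⊗ (α ⊗ β) ≈ s →
      z ⊗ (A′ ⊗ B′) ⊕ z ⊗ (A ⊗ B) ≈ (z ⊗ (A ⊗ B′) ⊕ z ⊗ (A′ ⊗ B)) ⊕ s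
    bilinear {z} {s} {A} {A′} {B} {B′} {α} {β} A′≈ B′≈ s≈ = begin
      z ⊗ (A′ ⊗ B′) ⊕ z ⊗ (A ⊗ B)
        ≈⟨ +-congʳ (*-congˡ (*-cong A′≈ B′≈)) ⟩
      z ⊗ ((A ⊕ α) ⊗ (B ⊕ β)) ⊕ z ⊗ (A ⊗ B)
        ≈⟨ solve 5 (λ z A α B β → z :* ((A :+ α) :* (B :+ β)) :+ z :* (A :* B)
                               := (z :* (A :* (B :+ β)) :+ z :* ((A :+ α) :* B)) :+ z :* (α :* β))
             refl z A α B β ⟩
      (z ⊗ (A ⊗ (B ⊕ β)) ⊕ z ⊗ ((A ⊕ α) ⊗ B)) ⊕ z ⊗ (α ⊗ β)
        ≈⟨ +-cong (+-cong (*-congˡ (*-congˡ B′≈)) (*-congˡ (*-congʳ A′≈))) (sym s≈) ⟨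
      (z ⊗ (A ⊗ B′) ⊕ z ⊗ (A′ ⊗ B)) ⊕ s ∎

    collect : ∀ {k m n m′} x y → k + (m + n) ≡ m′ →
      Q^ k ⊗ ((Q^ m ⊗ x) ⊗ (Q^ n ⊗ y)) ≈ Q^ m′ ⊗ (x ⊗ y)
    collect {k} {m} {n} {m′} x y eq = begin
      Q^ k ⊗ ((Q^ m ⊗ x) ⊗ (Q^ n ⊗ y))
        ≈⟨ solve 5 (λ k m n x y → k :* ((m :* x) :* (n :* y)) := (k :* (m :* n)) :* (x :* y))
             refl (Q^ k) (Q^ m) (Q^ n) x y ⟩
      (Q^ k ⊗ (Q^ m ⊗ Q^ n)) ⊗ (x ⊗ y)
        ≈⟨ *-congʳ (trans (*-congˡ (q^-+ m n)) (trans (q^-+ k (m + n)) (q^-cong eq))) ⟩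
      Q^ m′ ⊗ (x ⊗ y) ∎

    vanishʳ : ∀ w x {y} → y ≈ 0# → w ⊗ (x ⊗ y) ≈ 0#
    vanishʳ w x y≈0 = trans (*-congˡ (trans (*-congˡ y≈0) (zeroʳ x))) (zeroʳ w)

    vanishˡ : ∀ w {x} y → x ≈ 0# → w ⊗ (x ⊗ y) ≈ 0#
    vanishˡ w y x≈0 = trans (*-congˡ (*-comm _ _)) (vanishʳ w y x≈0)

    -- The exponent ν² is made for this: (k+1)² + (a-k) + (b-k) = (a+b+1) + k². The differences are
    -- exact only for k ≤ a and k ≤ b; otherwise a binomial vanishes on both sides.
    free-Δ : ∀ a b ν → Q^ (ν * ν) ⊗ (Δ a ν ⊗ Δ b ν) ≈ shift (suc (a + b)) (free a b) ν
    free-Δ a b zero    = vanishˡ _ _ refl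
    free-Δ a b (suc k) with ℕ.≤-<-connex k a | ℕ.≤-<-connex k b
    ... | inj₂ a<k | _        = trans (vanishˡ _ _ (trans (*-congˡ Ga≈0) (zeroʳ _)))
                                      (sym (trans (*-congˡ (vanishˡ _ _ Ga≈0)) (zeroʳ _)))
      where Ga≈0 = reflexive (G-zero a<k)
    ... | inj₁ _   | inj₂ b<k = trans (vanishʳ _ _ (trans (*-congˡ Gb≈0) (zeroʳ _)))
                                      (sym (trans (*-congˡ (vanishʳ _ _ Gb≈0)) (zeroʳ _)))
      where Gb≈0 = reflexive (G-zero b<k)
    ... | inj₁ k≤a | inj₁ k≤b = begin
      Q^ (suc k * suc k) ⊗ (Δ a (suc k) ⊗ Δ b (suc k))
        ≈⟨ collect (G a k) (G b k) (exponent k≤a k≤b) ⟩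
      Q^ (suc (a + b) + k * k) ⊗ (G a k ⊗ G b k)
        ≈⟨ trans (*-congʳ (sym (q^-+ _ _))) (*-assoc _ _ _) ⟩
      Q^ (suc (a + b)) ⊗ free a b k ∎
      where
      exponent : ∀ {a b k} → k ≤ a → k ≤ b → suc k * suc k + ((a ∸ k) + (b ∸ k)) ≡ suc (a + b) + k * k
      exponent {k = k} k≤a k≤b with ℕ.m≤n⇒∃[o]m+o≡n k≤a | ℕ.m≤n⇒∃[o]m+o≡n k≤b
      ... | a , ≡.refl | b , ≡.refl rewrite ℕ.m+n∸m≡n k a | ℕ.m+n∸m≡n k b =
        NS.solve 3 (λ k a b → (NS.con 1 NS.:+ k) NS.:* (NS.con 1 NS.:+ k) NS.:+ (a NS.:+ b)
                       NS.:= NS.con 1 NS.:+ ((k NS.:+ a) NS.:+ (k NS.:+ b)) NS.:+ k NS.:* k) ≡.refl k a b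

    free-recurrence : ∀ a b ν → free (suc a) (suc b) ν ⊕ free a b ν
      ≈ (free a (suc b) ν ⊕ free (suc a) b ν) ⊕ shift (suc (a + b)) (free a b) ν
    free-recurrence a b ν = bilinear (G-pascal a ν) (G-pascal b ν) (free-Δ a b ν)

    module _ {a b M : ℕ} (a+e≡1+M : a + e ≡ suc M) where

      ΔC : ℕ → Carrier
      ΔC zero    = 0#
      ΔC (suc k) = Δ M k

      C-current : ∀ k → C a (suc k) ≡ G M k
      C-current k = ≡.cong (λ n → G (n ∸ 1) k) a+e≡1+M

      C-pascal : ∀ ν → C (suc a) ν ≈ C a ν ⊕ ΔC ν
      C-pascal zero    = sym (+-identityʳ 0#)
      C-pascal (suc k) = begin
        G (a + e) k   ≡⟨ ≡.cong (λ n → G n k) a+e≡1+M ⟩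
        G (suc M) k   ≈⟨ G-pascal M k ⟩
        G M k ⊕ Δ M k ≡⟨ ≡.cong (_⊕ Δ M k) (C-current k) ⟨
        C a (suc k) ⊕ ΔC (suc k) ∎

      S-pascal : e ≤ suc b → ∀ ν → S (suc b) ν ≈ S b ν ⊕ Δ (suc b ∸ e) (suc ν)
      S-pascal e≤1+b ν = trans (reflexive (≡.cong (λ n → G n (suc ν)) (ℕ.+-∸-assoc 1 e≤1+b)))
                               (G-pascal (suc b ∸ e) (suc ν))

      -- The exponents match as in `free-Δ`: the upper indices b+1-e and a+e-1 also add up to a + b,
      -- and the shifts ν+1 and ν-1 of the lower indices compensate each other.
      reflected-Δ : e ≤ suc b → ∀ ν →
        (Q^ (ν * ν) ⊗ Q^ e) ⊗ (ΔC ν ⊗ Δ (suc b ∸ e) (suc ν)) ≈ shift (suc (a + b)) (reflected a b) ν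
      reflected-Δ e≤1+b zero          = vanishˡ _ _ refl
      reflected-Δ e≤1+b (suc zero)    = trans (vanishˡ _ _ refl) (sym (trans (*-congˡ (vanishˡ _ _ refl)) (zeroʳ _)))
      reflected-Δ e≤1+b (suc (suc j)) with ℕ.≤-<-connex j M | ℕ.≤-<-connex (suc (suc j)) N
        where N = suc b ∸ e
      ... | inj₂ M<j | _ = trans (vanishˡ _ _ (trans (*-congˡ GM≈0) (zeroʳ _)))
              (sym (trans (*-congˡ (vanishˡ _ _ (trans (reflexive (C-current j)) GM≈0))) (zeroʳ _)))
        where GM≈0 = reflexive (G-zero M<j)
      ... | inj₁ _ | inj₂ N<j+2 = trans (vanishʳ _ _ (trans (*-congˡ GN≈0) (zeroʳ _)))
              (sym (trans (*-congˡ (vanishʳ _ _ GN≈0)) (zeroʳ _)))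
        where GN≈0 = reflexive (G-zero N<j+2)
      ... | inj₁ j≤M | inj₁ j+2≤N = begin
        (Q^ (k * k) ⊗ Q^ e) ⊗ ((Q^ (M ∸ j) ⊗ G M j) ⊗ (Q^ (N ∸ k) ⊗ G N k))
          ≈⟨ *-congʳ (q^-+ (k * k) e) ⟩
        Q^ (k * k + e) ⊗ ((Q^ (M ∸ j) ⊗ G M j) ⊗ (Q^ (N ∸ k) ⊗ G N k))
          ≈⟨ collect (G M j) (G N k) (exponent j≤M j+2≤N N+M≡a+b) ⟩
        Q^ (suc (a + b) + (suc j * suc j + e)) ⊗ (G M j ⊗ G N k)
          ≈⟨ *-congʳ (trans (*-congˡ (q^-+ _ _)) (q^-+ _ _)) ⟨
        (Q^ (suc (a + b)) ⊗ (Q^ (suc j * suc j) ⊗ Q^ e)) ⊗ (G M j ⊗ G N k)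
          ≈⟨ *-assoc _ _ _ ⟩
        Q^ (suc (a + b)) ⊗ ((Q^ (suc j * suc j) ⊗ Q^ e) ⊗ (G M j ⊗ G N k))
          ≡⟨ ≡.cong (λ g → Q^ (suc (a + b)) ⊗ ((Q^ (suc j * suc j) ⊗ Q^ e) ⊗ (g ⊗ G N k))) (C-current j) ⟨
        Q^ (suc (a + b)) ⊗ reflected a b (suc j) ∎
        where
        N k : ℕ
        N = suc b ∸ e
        k = suc (suc j)
        N+M≡a+b : N + M ≡ a + b
        N+M≡a+b = ℕ.suc-injective (≡.trans (≡.sym (ℕ.+-suc N M))
          (≡.trans (≡.cong (λ m → N + m) (≡.sym a+e≡1+M))
          (≡.trans (NS.solve 3 (λ N a e → N NS.:+ (a NS.:+ e) NS.:= a NS.:+ (N NS.:+ e)) ≡.refl N a e)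
          (≡.trans (≡.cong (λ m → a + m) (ℕ.m∸n+n≡m e≤1+b)) (ℕ.+-suc a b)))))
        exponent : ∀ {M N j s} → j ≤ M → suc (suc j) ≤ N → N + M ≡ s →
          (suc (suc j) * suc (suc j) + e) + ((M ∸ j) + (N ∸ suc (suc j))) ≡ suc s + (suc j * suc j + e)
        exponent {j = j} j≤M j+2≤N ≡.refl with ℕ.m≤n⇒∃[o]m+o≡n j≤M | ℕ.m≤n⇒∃[o]m+o≡n j+2≤N
        ... | m , ≡.refl | n , ≡.refl rewrite ℕ.m+n∸m≡n j m | ℕ.m+n∸m≡n j n =
          NS.solve 4 (λ j m n e →
            ((NS.con 2 NS.:+ j) NS.:* (NS.con 2 NS.:+ j) NS.:+ e) NS.:+ (m NS.:+ n)
              NS.:= NS.con 1 NS.:+ ((NS.con 2 NS.:+ j NS.:+ n) NS.:+ (j NS.:+ m))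
                   NS.:+ ((NS.con 1 NS.:+ j) NS.:* (NS.con 1 NS.:+ j) NS.:+ e)) ≡.refl j m n e

      S-zero : ∀ {b} → suc b ≤ e → ∀ ν → S b ν ≈ 0#
      S-zero 1+b≤e ν = reflexive (≡.cong (λ n → G n (suc ν)) (ℕ.m≤n⇒m∸n≡0 1+b≤e))

      reflected-recurrence : ∀ ν → reflected (suc a) (suc b) ν ⊕ reflected a b ν
        ≈ (reflected a (suc b) ν ⊕ reflected (suc a) b ν) ⊕ shift (suc (a + b)) (reflected a b) ν
      reflected-recurrence ν with ℕ.≤-<-connex e (suc b)
      ... | inj₁ e≤1+b = bilinear (C-pascal ν) (S-pascal e≤1+b ν) (reflected-Δ e≤1+b ν)
      -- Here b + 2 ≤ e, so `S b` and `S (suc b)` both have upper index 0 and vanish; the truncated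
      -- index does not grow, and the increment is 0 rather than a q-Pascal one.
      ... | inj₂ 1+b<e = bilinear {β = 0#} (C-pascal ν)
              (trans (S-zero 1+b<e ν) (sym (trans (+-identityʳ _) (S-zero (ℕ.<⇒≤ 1+b<e) ν))))
              (trans (vanishʳ _ _ refl) (sym (shift-zero ν)))
        where
        shift-zero : ∀ ν → shift (suc (a + b)) (reflected a b) ν ≈ 0#
        shift-zero zero    = refl
        shift-zero (suc k) = trans (*-congˡ (vanishʳ _ _ (S-zero (ℕ.<⇒≤ 1+b<e) k))) (zeroʳ _)

      φ-recurrence : ∀ ν → φ (suc a) (suc b) ν ⊕ φ a b ν
        ≈ (φ a (suc b) ν ⊕ φ (suc a) b ν) ⊕ shift (suc (a + b)) (φ a b) ν
      φ-recurrence ν = begin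
        φ (suc a) (suc b) ν ⊕ φ a b ν
          ≈⟨ ⊝-+ _ _ _ _ ⟩
        (free (suc a) (suc b) ν ⊕ free a b ν) ⊝ (reflected (suc a) (suc b) ν ⊕ reflected a b ν)
          ≈⟨ +-cong (free-recurrence a b ν) (-‿cong (reflected-recurrence ν)) ⟩
        ((free a (suc b) ν ⊕ free (suc a) b ν) ⊕ shift (suc (a + b)) (free a b) ν)
          ⊝ ((reflected a (suc b) ν ⊕ reflected (suc a) b ν) ⊕ shift (suc (a + b)) (reflected a b) ν)
          ≈⟨ trans (+-congʳ (⊝-+ _ _ _ _)) (⊝-+ _ _ _ _) ⟨
        (φ a (suc b) ν ⊕ φ (suc a) b ν) ⊕ (shift (suc (a + b)) (free a b) ν ⊝ shift (suc (a + b)) (reflected a b) ν)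
          ≈⟨ +-congˡ (shift-⊝ ν) ⟩
        (φ a (suc b) ν ⊕ φ (suc a) b ν) ⊕ shift (suc (a + b)) (φ a b) ν ∎
        where
        ⊝-+ : ∀ x y z w → (x ⊝ y) ⊕ (z ⊝ w) ≈ (x ⊕ z) ⊝ (y ⊕ w)
        ⊝-+ x y z w = trans (interchange _ _ _ _) (+-congˡ (⁻¹-∙-comm y w))
        shift-⊝ : ∀ ν → shift (suc (a + b)) (free a b) ν ⊝ shift (suc (a + b)) (reflected a b) ν
                      ≈ shift (suc (a + b)) (φ a b) ν
        shift-⊝ zero    = -‿inverseʳ 0#
        shift-⊝ (suc k) = trans (+-congˡ (-‿distribʳ-* _ _)) (sym (distribˡ _ _ _))

    -- Both increments are multiples of [a+1, ν] [a+e, ν-1], with the two binomials in exchanged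
    -- roles. Their powers of q agree since e + (a+1-ν) = a+e-(ν-1), which is what the factor q^e is
    -- for.
    φ-boundary : ∀ a ν → φ (suc a) (suc (a + e)) ν ≈ φ (suc a) (a + e) ν
    φ-boundary a ν = begin
      z ⊗ (G (suc a) ν ⊗ G (suc (a + e)) ν) ⊝ w ⊗ (C (suc a) ν ⊗ S (suc (a + e)) ν)
        ≈⟨ +-cong (*-congˡ (*-congˡ (G-pascal (a + e) ν))) (-‿cong (*-congˡ (*-congˡ S-step))) ⟩
      z ⊗ (G (suc a) ν ⊗ (G (a + e) ν ⊕ Δ (a + e) ν))
        ⊝ w ⊗ (C (suc a) ν ⊗ (S (a + e) ν ⊕ Δ (suc a) (suc ν)))
        ≈⟨ +-cong (expand _ _ _ _) (-‿cong (trans (expand _ _ _ _) (+-congˡ (sym (increments ν))))) ⟩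
      (free (suc a) (a + e) ν ⊕ d) ⊝ (reflected (suc a) (a + e) ν ⊕ d)
        ≈⟨ trans (+-congˡ (sym (⁻¹-∙-comm _ _))) (interchange _ _ _ _) ⟩
      φ (suc a) (a + e) ν ⊕ (d ⊝ d)
        ≈⟨ trans (+-congˡ (-‿inverseʳ d)) (+-identityʳ _) ⟩
      φ (suc a) (a + e) ν ∎
      where
      z w d : Carrier
      z = Q^ (ν * ν)
      w = z ⊗ Q^ e
      d = z ⊗ (G (suc a) ν ⊗ Δ (a + e) ν)
      S-step : S (suc (a + e)) ν ≈ S (a + e) ν ⊕ Δ (suc a) (suc ν)
      S-step rewrite ℕ.m+n∸n≡m (suc a) e | ℕ.m+n∸n≡m (suc (suc a)) e = G-pascal (suc a) (suc ν)
      expand : ∀ t x y y′ → t ⊗ (x ⊗ (y ⊕ y′)) ≈ t ⊗ (x ⊗ y) ⊕ t ⊗ (x ⊗ y′)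
      expand t x y y′ = trans (*-congˡ (distribˡ x y y′)) (distribˡ t _ _)
      increments : ∀ ν → Q^ (ν * ν) ⊗ (G (suc a) ν ⊗ Δ (a + e) ν)
                       ≈ (Q^ (ν * ν) ⊗ Q^ e) ⊗ (C (suc a) ν ⊗ Δ (suc a) (suc ν))
      increments zero    = trans (vanishʳ _ _ refl) (sym (vanishˡ _ _ refl))
      increments (suc k) with ℕ.≤-<-connex k a
      ... | inj₁ k≤a = trans
              (*-congˡ (*-congˡ (*-congʳ (sym (trans (q^-+ e (a ∸ k)) (q^-cong exponent))))))
              (solve 5 (λ z g e p h → z :* (g :* ((e :* p) :* h)) := (z :* e) :* (h :* (p :* g)))
                 refl (Q^ (suc k * suc k)) (G (suc a) (suc k)) (Q^ e) (Q^ (a ∸ k)) (G (a + e) k))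
        where
        exponent : e + (a ∸ k) ≡ a + e ∸ k
        exponent = ≡.trans (≡.sym (ℕ.+-∸-assoc e k≤a)) (≡.cong (_∸ k) (ℕ.+-comm e a))
      ... | inj₂ a<k = trans (vanishˡ _ _ Ga≈0) (sym (vanishʳ _ _ (trans (*-congˡ Ga≈0) (zeroʳ _))))
        where Ga≈0 = reflexive (G-zero (s≤s a<k))

    δ₀ : ℕ → Carrier
    δ₀ zero    = 1#
    δ₀ (suc _) = 0#

    φ-free : ∀ a b ν → free a b ν ≈ δ₀ ν → reflected a b ν ≈ 0# → φ a b ν ≈ δ₀ ν
    φ-free a b ν f≈ r≈ = trans (+-cong f≈ (trans (-‿cong r≈) -0#≈0#)) (+-identityʳ _)

    free-constant : ∀ a b → free a b 0 ≈ 1#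
    free-constant a b = trans (*-congʳ q^-zero) (trans (*-identityˡ _) (*-identityˡ _))

    -- For ν ≥ 1 the free term contains [0, ν] = 0. The reflected term contains a binomial with
    -- upper index at most 1 and lower index at least 2. For ν = 0 the factor `C` vanishes.
    φ-leftEdge : ∀ {b} → b ≤ e → ∀ ν → φ 0 b ν ≈ δ₀ ν
    φ-leftEdge {b} b≤e zero    = φ-free 0 b 0 (free-constant 0 b) (vanishˡ _ _ refl)
    φ-leftEdge {b} b≤e (suc k) = φ-free 0 b (suc k) (vanishˡ _ _ refl)
      (vanishʳ _ _ (reflexive (G-zero (s≤s (ℕ.≤-trans 1+b∸e≤1 (s≤s z≤n))))))
      where
      1+b∸e≤1 : suc b ∸ e ≤ 1
      1+b∸e≤1 = ℕ.m≤n+o⇒m∸n≤o (suc b) e (ℕ.≤-trans (s≤s b≤e) (ℕ.≤-reflexive (ℕ.+-comm 1 e)))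

    φ-bottomEdge : ∀ a ν → φ a 0 ν ≈ δ₀ ν
    φ-bottomEdge a zero    = φ-free a 0 0 (free-constant a 0) (vanishˡ _ _ refl)
    φ-bottomEdge a (suc k) = φ-free a 0 (suc k) (vanishʳ _ _ refl)
      (vanishʳ _ _ (reflexive (G-zero (s≤s (ℕ.≤-trans (ℕ.m∸n≤m 1 e) (s≤s z≤n))))))

    φ-factored : ∀ a b ν → φ a b ν ≈ Q^ (ν * ν) ⊗ (G a ν ⊗ G b ν ⊝ Q^ e ⊗ (S b ν ⊗ C a ν))
    φ-factored a b ν = sym (begin
      z ⊗ (g ⊝ Q^ e ⊗ (S b ν ⊗ C a ν))
        ≈⟨ distribˡ z g _ ⟩
      z ⊗ g ⊕ z ⊗ (⊖ (Q^ e ⊗ (S b ν ⊗ C a ν)))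
        ≈⟨ +-congˡ (trans (sym (-‿distribʳ-* z _)) (-‿cong
             (solve 4 (λ z x s c → z :* (x :* (s :* c)) := (z :* x) :* (c :* s)) refl z (Q^ e) (S b ν) (C a ν)))) ⟩
      φ a b ν ∎)
      where
      z g : Carrier
      z = Q^ (ν * ν)
      g = G a ν ⊗ G b ν

-- Generating functions of weak chains

module ListSums {c ℓ : Level} (R : CommutativeRing c ℓ) where
  open CommutativeRing R hiding (zero; rawRing) renaming (_+_ to _⊕_; _*_ to _⊗_)
  open CommutativeSemigroupProperties +-commutativeSemigroup using (interchange)
  open import Relation.Binary.Reasoning.Setoid setoid

  -- The Iverson bracket: sums over different order ideals become sums over one list and can be
  -- compared summand by summand.
  infix 8 [_]_
  [_]_ : Bool → Carrier → Carrier
  [ b ] x = if b then x else 0#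

  []-cong : ∀ b {x y} → x ≈ y → [ b ] x ≈ [ b ] y
  []-cong true  x≈y = x≈y
  []-cong false _   = refl

  []-∧ : ∀ b b′ x → [ b ∧ b′ ] x ≈ [ b ] [ b′ ] x
  []-∧ true  b′ x = refl
  []-∧ false b′ x = refl

  []-⊗ʳ : ∀ b x y → [ b ] (x ⊗ y) ≈ x ⊗ [ b ] y
  []-⊗ʳ true  x y = refl
  []-⊗ʳ false x y = sym (zeroʳ x)

  []-⊗ˡ : ∀ b x y → [ b ] (x ⊗ y) ≈ [ b ] x ⊗ y
  []-⊗ˡ true  x y = refl
  []-⊗ˡ false x y = sym (zeroˡ y)

  module _ {A : Set} where

    Σ : List A → (A → Carrier) → Carrier
    Σ xs f = foldr _⊕_ 0# (map f xs)

    Σ-cong : ∀ xs {f g : A → Carrier} → (∀ x → f x ≈ g x) → Σ xs f ≈ Σ xs g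
    Σ-cong []       f≈g = refl
    Σ-cong (x ∷ xs) f≈g = +-cong (f≈g x) (Σ-cong xs f≈g)

    Σ-0# : ∀ (xs : List A) → Σ xs (λ _ → 0#) ≈ 0#
    Σ-0# []       = refl
    Σ-0# (x ∷ xs) = trans (+-identityˡ _) (Σ-0# xs)

    Σ-⊕ : ∀ xs (f g : A → Carrier) → Σ xs (λ x → f x ⊕ g x) ≈ Σ xs f ⊕ Σ xs g
    Σ-⊕ []       f g = sym (+-identityˡ 0#)
    Σ-⊕ (x ∷ xs) f g = trans (+-congˡ (Σ-⊕ xs f g)) (interchange _ _ _ _)

    Σ-⊗ˡ : ∀ xs a (f : A → Carrier) → a ⊗ Σ xs f ≈ Σ xs (λ x → a ⊗ f x)
    Σ-⊗ˡ []       a f = zeroʳ a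
    Σ-⊗ˡ (x ∷ xs) a f = trans (distribˡ _ _ _) (+-congˡ (Σ-⊗ˡ xs a f))

    Σ-⊗ʳ : ∀ xs a (f : A → Carrier) → Σ xs f ⊗ a ≈ Σ xs (λ x → f x ⊗ a)
    Σ-⊗ʳ []       a f = zeroˡ a
    Σ-⊗ʳ (x ∷ xs) a f = trans (distribʳ _ _ _) (+-congˡ (Σ-⊗ʳ xs a f))

    Σ-[] : ∀ xs b (f : A → Carrier) → [ b ] Σ xs f ≈ Σ xs (λ x → [ b ] f x)
    Σ-[] xs true  f = refl
    Σ-[] xs false f = sym (Σ-0# xs)

    Σ-++ : ∀ xs ys (f : A → Carrier) → Σ (xs ++ ys) f ≈ Σ xs f ⊕ Σ ys f
    Σ-++ []       ys f = sym (+-identityˡ _)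
    Σ-++ (x ∷ xs) ys f = trans (+-congˡ (Σ-++ xs ys f)) (sym (+-assoc _ _ _))

    Σ-filter : ∀ {P : Pred A 0ℓ} (P? : Decidable P) xs (f : A → Carrier) →
               Σ (filter P? xs) f ≈ Σ xs (λ x → [ does (P? x) ] f x)
    Σ-filter P? []       f = refl
    Σ-filter P? (x ∷ xs) f with does (P? x)
    ... | true  = +-congˡ (Σ-filter P? xs f)
    ... | false = trans (Σ-filter P? xs f) (sym (+-identityˡ _))

  Σ-map : ∀ {A B : Set} (h : A → B) xs f → Σ (map h xs) f ≈ Σ xs (f ∘ h)
  Σ-map h []       f = refl
  Σ-map h (x ∷ xs) f = +-congˡ (Σ-map h xs f)

  Σ-cartesianProductWith : ∀ {A B C : Set} (h : A → B → C) xs ys f →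
    Σ (cartesianProductWith h xs ys) f ≈ Σ xs (λ x → Σ ys (λ y → f (h x y)))
  Σ-cartesianProductWith h []       ys f = refl
  Σ-cartesianProductWith h (x ∷ xs) ys f =
    trans (Σ-++ (map (h x) ys) _ f) (+-cong (Σ-map (h x) ys f) (Σ-cartesianProductWith h xs ys f))

  Σ-swap : ∀ {A B : Set} xs ys (f : A → B → Carrier) →
    Σ xs (λ x → Σ ys (f x)) ≈ Σ ys (λ y → Σ xs (λ x → f x y))
  Σ-swap []       ys f = sym (Σ-0# ys)
  Σ-swap (x ∷ xs) ys f = trans (+-congˡ (Σ-swap xs ys f)) (sym (Σ-⊕ ys (f x) (λ y → Σ xs (λ x → f x y))))

  module _ (T : Setoid 0ℓ 0ℓ) (_≟_ : Decidable₂ (Setoid._≈_ T)) (f : Setoid.Carrier T → Carrier)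
           (f-cong : ∀ {x y} → Setoid._≈_ T x y → f x ≈ f y) where
    open Setoid T using () renaming (_≈_ to _≈ₜ_; trans to transₜ; sym to symₜ)
    open Membership T using (_∈_)

    Σ-absent : ∀ z {xs} → All (λ x → ¬ z ≈ₜ x) xs → Σ xs (λ x → [ does (x ≟ z) ] f x) ≈ 0#
    Σ-absent z []              = refl
    Σ-absent z {x ∷ _} (z≉x ∷ z∉) =
      trans (+-cong (reflexive (if-false (dec-false (x ≟ z) (z≉x ∘ symₜ)))) (Σ-absent z z∉)) (+-identityˡ 0#)

    -- Exactly one entry is equivalent to `z`, but it need not be `z` itself, hence `f-cong`.
    Σ-single : ∀ z {xs} → Unique T xs → z ∈ xs → Σ xs (λ x → [ does (x ≟ z) ] f x) ≈ f z
    Σ-single z {x ∷ xs} (x∉xs ∷ _) (here z≈x) =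
      trans (+-cong (trans (reflexive (if-true (dec-true (x ≟ z) (symₜ z≈x)))) (f-cong (symₜ z≈x)))
                    (Σ-absent z (All.map (λ x≉y z≈y → x≉y (transₜ (symₜ z≈x) z≈y)) x∉xs)))
            (+-identityʳ _)
    Σ-single z {x ∷ xs} (x∉xs ∷ u) (there z∈xs) =
      trans (+-cong (reflexive (if-false (dec-false (x ≟ z) (x≉ x∉xs z∈xs)))) (Σ-single z u z∈xs)) (+-identityˡ _)
      where
      x≉ : ∀ {x xs} → All (λ y → ¬ x ≈ₜ y) xs → z ∈ xs → ¬ x ≈ₜ z
      x≉ (x≉y ∷ _)  (here z≈y)  x≈z = x≉y (transₜ x≈z z≈y)
      x≉ (_ ∷ x∉ys) (there z∈ys) x≈z = x≉ x∉ys z∈ys x≈z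

module ChainSums {c ℓ : Level} (R : CommutativeRing c ℓ)
  {A : Set} (L : List A) {_⊑_ : Rel A 0ℓ} (_⊑?_ : Decidable₂ _⊑_)
  (w : A → CommutativeRing.Carrier R) (weight : List A → CommutativeRing.Carrier R)
  (weight-[] : CommutativeRing._≈_ R (weight []) (CommutativeRing.1# R))
  (weight-∷ : ∀ x xs → CommutativeRing._≈_ R (weight (x ∷ xs)) (CommutativeRing._*_ R (w x) (weight xs)))
  where
  open CommutativeRing R hiding (zero; rawRing) renaming (_+_ to _⊕_; _*_ to _⊗_)
  open ListSums R
  open SemiringSolver commutativeSemiring using (solve; _:+_; _:*_; _:=_)
  open import Relation.Binary.Reasoning.Setoid setoid

  chains : ℕ → Carrier
  chains m = Σ (filter (linked? _⊑?_) (words m L)) weight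

  -- Words grow at the front, so enumeration by `words` leads to `chainsAbove`; removing last
  -- elements requires `chainsBelow`.
  chainsAbove chainsBelow : ℕ → A → Carrier
  chainsAbove zero    z = 1#
  chainsAbove (suc m) z = Σ L (λ x → [ does (z ⊑? x) ] (w x ⊗ chainsAbove m x))
  chainsBelow zero    z = 1#
  chainsBelow (suc m) z = Σ L (λ x → [ does (x ⊑? z) ] (w x ⊗ chainsBelow m x))

  linked-words : ∀ m z → Σ (words m L) (λ xs → [ does (linked? _⊑?_ (z ∷ xs)) ] weight xs) ≈ chainsAbove m z
  linked-words zero    z = trans (+-identityʳ _) weight-[]
  linked-words (suc m) z = begin
    Σ (words (suc m) L) (λ xs → [ does (linked? _⊑?_ (z ∷ xs)) ] weight xs)
      ≈⟨ Σ-cartesianProductWith _∷_ L (words m L) (λ xs → [ does (linked? _⊑?_ (z ∷ xs)) ] weight xs) ⟩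
    Σ L (λ x → Σ (words m L) (λ xs → [ does (z ⊑? x) ∧ does (linked? _⊑?_ (x ∷ xs)) ] weight (x ∷ xs)))
      ≈⟨ Σ-cong L step ⟩
    chainsAbove (suc m) z ∎
    where
    step : ∀ x → Σ (words m L) (λ xs → [ does (z ⊑? x) ∧ does (linked? _⊑?_ (x ∷ xs)) ] weight (x ∷ xs))
               ≈ [ does (z ⊑? x) ] (w x ⊗ chainsAbove m x)
    step x = begin
      Σ (words m L) (λ xs → [ does (z ⊑? x) ∧ linked xs ] weight (x ∷ xs))
        ≈⟨ Σ-cong (words m L) (λ xs → trans ([]-∧ (does (z ⊑? x)) (linked xs) _)
             ([]-cong (does (z ⊑? x)) (trans ([]-cong (linked xs) (weight-∷ x xs)) ([]-⊗ʳ (linked xs) _ _)))) ⟩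
      Σ (words m L) (λ xs → [ does (z ⊑? x) ] (w x ⊗ [ linked xs ] weight xs))
        ≈⟨ Σ-[] (words m L) (does (z ⊑? x)) (λ xs → w x ⊗ [ linked xs ] weight xs) ⟨
      [ does (z ⊑? x) ] Σ (words m L) (λ xs → w x ⊗ [ linked xs ] weight xs)
        ≈⟨ []-cong (does (z ⊑? x)) (trans (sym (Σ-⊗ˡ (words m L) (w x) (λ xs → [ linked xs ] weight xs)))
                                          (*-congˡ (linked-words m x))) ⟩
      [ does (z ⊑? x) ] (w x ⊗ chainsAbove m x) ∎
      where
      linked : List A → Bool
      linked xs = does (linked? _⊑?_ (x ∷ xs))

  chains-suc : ∀ m → chains (suc m) ≈ Σ L (λ x → w x ⊗ chainsAbove m x)
  chains-suc m = begin
    chains (suc m)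
      ≈⟨ Σ-filter (linked? _⊑?_) (words (suc m) L) weight ⟩
    Σ (words (suc m) L) (λ xs → [ does (linked? _⊑?_ xs) ] weight xs)
      ≈⟨ Σ-cartesianProductWith _∷_ L (words m L) (λ xs → [ does (linked? _⊑?_ xs) ] weight xs) ⟩
    Σ L (λ x → Σ (words m L) (λ xs → [ does (linked? _⊑?_ (x ∷ xs)) ] weight (x ∷ xs)))
      ≈⟨ Σ-cong L (λ x → trans
           (Σ-cong (words m L) (λ xs → trans ([]-cong (does (linked? _⊑?_ (x ∷ xs))) (weight-∷ x xs))
                                             ([]-⊗ʳ (does (linked? _⊑?_ (x ∷ xs))) _ _)))
           (trans (sym (Σ-⊗ˡ (words m L) (w x) (λ xs → [ does (linked? _⊑?_ (x ∷ xs)) ] weight xs)))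
                  (*-congˡ (linked-words m x)))) ⟩
    Σ L (λ x → w x ⊗ chainsAbove m x) ∎

  -- Chains of length k + m + 1, split at the (k+1)-st element x.  Moving the split
  -- from first to last turns chains above an element into chains below it.
  pivot : ℕ → ℕ → Carrier
  pivot k m = Σ L (λ x → chainsBelow k x ⊗ (w x ⊗ chainsAbove m x))

  -- Both sides are sums over consecutive chain elements `y ⊑ x`, taken in opposite orders of
  -- summation.
  pivot-shift : ∀ k m → pivot (suc k) m ≈ pivot k (suc m)
  pivot-shift k m = begin
    Σ L (λ x → Σ L (λ y → [ does (y ⊑? x) ] (w y ⊗ chainsBelow k y)) ⊗ (w x ⊗ chainsAbove m x))
      ≈⟨ Σ-cong L (λ x → Σ-⊗ʳ L (w x ⊗ chainsAbove m x) (λ y → [ does (y ⊑? x) ] (w y ⊗ chainsBelow k y))) ⟩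
    Σ L (λ x → Σ L (λ y → [ does (y ⊑? x) ] (w y ⊗ chainsBelow k y) ⊗ (w x ⊗ chainsAbove m x)))
      ≈⟨ Σ-swap L L (λ x y → [ does (y ⊑? x) ] (w y ⊗ chainsBelow k y) ⊗ (w x ⊗ chainsAbove m x)) ⟩
    Σ L (λ y → Σ L (λ x → [ does (y ⊑? x) ] (w y ⊗ chainsBelow k y) ⊗ (w x ⊗ chainsAbove m x)))
      ≈⟨ Σ-cong L (λ y → trans
           (Σ-cong L (λ x → rearrange (does (y ⊑? x)) (w y) (chainsBelow k y) (w x ⊗ chainsAbove m x)))
           (trans (sym (Σ-⊗ˡ L (chainsBelow k y) (λ x → w y ⊗ [ does (y ⊑? x) ] (w x ⊗ chainsAbove m x))))
                  (*-congˡ (sym (Σ-⊗ˡ L (w y) (λ x → [ does (y ⊑? x) ] (w x ⊗ chainsAbove m x))))))) ⟩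
    Σ L (λ y → chainsBelow k y ⊗ (w y ⊗ Σ L (λ x → [ does (y ⊑? x) ] (w x ⊗ chainsAbove m x)))) ∎
    where
    rearrange : ∀ b u v z → [ b ] (u ⊗ v) ⊗ z ≈ v ⊗ (u ⊗ [ b ] z)
    rearrange b u v z = begin
      [ b ] (u ⊗ v) ⊗ z  ≈⟨ []-⊗ˡ b _ _ ⟨
      [ b ] (u ⊗ v ⊗ z)  ≈⟨ []-⊗ʳ b _ _ ⟩
      u ⊗ v ⊗ [ b ] z    ≈⟨ solve 3 (λ u v z → u :* v :* z := v :* (u :* z)) refl u v ([ b ] z) ⟩
      v ⊗ (u ⊗ [ b ] z)  ∎

  pivot-exchange : ∀ k m → pivot k m ≈ pivot (k + m) 0
  pivot-exchange k zero    = reflexive (≡.cong (λ n → pivot n 0) (≡.sym (ℕ.+-identityʳ k)))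
  pivot-exchange k (suc m) = trans (sym (pivot-shift k m))
    (trans (pivot-exchange (suc k) m) (reflexive (≡.cong (λ n → pivot n 0) (≡.sym (ℕ.+-suc k m)))))

  chains-below-maximum : ∀ {top} → (∀ x → x ⊑ top) → ∀ m → chains m ≈ chainsBelow m top
  chains-below-maximum {top} x⊑top zero    = trans (+-identityʳ _) weight-[]
  chains-below-maximum {top} x⊑top (suc m) = begin
    chains (suc m)                        ≈⟨ chains-suc m ⟩
    Σ L (λ x → w x ⊗ chainsAbove m x)      ≈⟨ Σ-cong L (λ x → sym (*-identityˡ _)) ⟩
    pivot 0 m                             ≈⟨ pivot-exchange 0 m ⟩
    pivot m 0                             ≈⟨ Σ-cong L (λ x → trans (*-comm _ _)
                                               (trans (*-congʳ (*-identityʳ _)) (sym (reflexive (if-true (dec-true (x ⊑? top) (x⊑top x))))))) ⟩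
    chainsBelow (suc m) top               ∎

-- Clearing geometric denominators

module GeometricFactors {c ℓ : Level} (R : CommutativeRing c ℓ) where
  open CommutativeRing R hiding (zero) renaming (_+_ to _⊕_; _*_ to _⊗_; _-_ to _⊝_)
  open RingProperties ring using (+-cancelʳ)
  open CommutativeSemigroupProperties +-commutativeSemigroup using (xy∙z≈xz∙y)
  open SemiringSolver commutativeSemiring using (solve; _:+_; _:*_; _:=_)
  open import Relation.Binary.Reasoning.Setoid setoid

  *-[1-x]-+ : ∀ f x → f ⊗ (1# ⊝ x) ⊕ x ⊗ f ≈ f
  *-[1-x]-+ f x = begin
    f ⊗ (1# ⊝ x) ⊕ x ⊗ f     ≈⟨ +-cong (*-comm _ _) refl ⟩
    (1# ⊝ x) ⊗ f ⊕ x ⊗ f     ≈⟨ distribʳ f _ x ⟨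
    (1# ⊝ x ⊕ x) ⊗ f         ≈⟨ *-congʳ (trans (+-assoc _ _ _) (trans (+-congˡ (-‿inverseˡ x)) (+-identityʳ 1#))) ⟩
    1# ⊗ f                   ≈⟨ *-identityˡ f ⟩
    f ∎

  geometric : ∀ {f g x} → f ≈ g ⊕ x ⊗ f → f ⊗ (1# ⊝ x) ≈ g
  geometric {f} {g} {x} f≈ = +-cancelʳ (x ⊗ f) _ _ (trans (*-[1-x]-+ f x) f≈)

  geometric₂ : ∀ {f g h x} → f ⊕ h ≈ g ⊕ x ⊗ f → f ⊗ (1# ⊝ x) ⊕ h ≈ g
  geometric₂ {f} {g} {h} {x} f+h≈ = +-cancelʳ (x ⊗ f) _ _
    (trans (xy∙z≈xz∙y _ _ _) (trans (+-congʳ (*-[1-x]-+ f x)) f+h≈))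

  clear-one : ∀ {f g x d d′} → d′ ≈ d ⊗ (1# ⊝ x) → f ≈ g ⊕ x ⊗ f → f ⊗ d′ ≈ g ⊗ d
  clear-one {f} {g} {x} {d} {d′} d′≈ f≈ = begin
    f ⊗ d′              ≈⟨ *-congˡ d′≈ ⟩
    f ⊗ (d ⊗ (1# ⊝ x))  ≈⟨ solve 3 (λ f d y → f :* (d :* y) := (f :* y) :* d) refl f d (1# ⊝ x) ⟩
    f ⊗ (1# ⊝ x) ⊗ d    ≈⟨ *-congʳ (geometric f≈) ⟩
    g ⊗ d ∎

  -- Everything is multiplied by `d₁`, the denominator of the two covers. The one that belongs to
  -- `f₃` is `d₀`, and since `d₁` is `d₀ ⊗ (1# ⊝ y)`, the surplus factor leaves the term
  -- `y ⊗ (f₃ ⊗ d₀)`.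
  clear-two : ∀ {f f₁ f₂ f₃ x y d₀ d₁ d₂} → d₂ ≈ d₁ ⊗ (1# ⊝ x) → d₁ ≈ d₀ ⊗ (1# ⊝ y) →
    f ⊕ f₃ ≈ (f₁ ⊕ f₂) ⊕ x ⊗ f → f ⊗ d₂ ⊕ f₃ ⊗ d₀ ≈ (f₁ ⊗ d₁ ⊕ f₂ ⊗ d₁) ⊕ y ⊗ (f₃ ⊗ d₀)
  clear-two {f} {f₁} {f₂} {f₃} {x} {y} {d₀} {d₁} {d₂} d₂≈ d₁≈ f≈ = begin
    f ⊗ d₂ ⊕ f₃ ⊗ d₀
      ≈⟨ +-cong (*-congˡ d₂≈) (sym (*-[1-x]-+ (f₃ ⊗ d₀) y)) ⟩
    f ⊗ (d₁ ⊗ (1# ⊝ x)) ⊕ (f₃ ⊗ d₀ ⊗ (1# ⊝ y) ⊕ y ⊗ (f₃ ⊗ d₀))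
      ≈⟨ +-congˡ (+-congʳ (trans (*-assoc _ _ _) (*-congˡ (sym d₁≈)))) ⟩
    f ⊗ (d₁ ⊗ (1# ⊝ x)) ⊕ (f₃ ⊗ d₁ ⊕ y ⊗ (f₃ ⊗ d₀))
      ≈⟨ solve 5 (λ f d z h r → f :* (d :* z) :+ (h :* d :+ r) := (f :* z :+ h) :* d :+ r)
           refl f d₁ (1# ⊝ x) f₃ (y ⊗ (f₃ ⊗ d₀)) ⟩
    (f ⊗ (1# ⊝ x) ⊕ f₃) ⊗ d₁ ⊕ y ⊗ (f₃ ⊗ d₀)
      ≈⟨ +-congʳ (trans (*-congʳ (geometric₂ f≈)) (distribʳ d₁ f₁ f₂)) ⟩
    (f₁ ⊗ d₁ ⊕ f₂ ⊗ d₁) ⊕ y ⊗ (f₃ ⊗ d₀) ∎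

-- Chain series and lower covers

module PosetSeries {c ℓ : Level} (R : CommutativeRing c ℓ) (powers : QPowers R) (P : GradedPoset) where
  open CommutativeRing R hiding (zero; rawRing)
    renaming (Carrier to K; _+_ to _⊕_; _*_ to _⊗_; _≈_ to _≈ᵣ_)
  open QPowers powers
  open GradedPoset P hiding (setoid)
  open DecPoset decPoset using (antisym; module Eq)
  open ListSums R
  open ChainSums R elements _≤?_ (λ z → Q^ rank z) (λ xs → Q^ sum (map rank xs)) q^-zero
    (λ x xs → sym (q^-+ (rank x) (sum (map rank xs)))) public
  open PowerSeries (CommutativeRing.rawRing R) using (Series; const; var^)
  open PowerSeriesProperties R
  open import Relation.Binary.Reasoning.Setoid setoid

  below : (Carrier → K) → Carrier → K
  below f z = Σ elements (λ x → [ does (x ≤? z) ] f x)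

  chainsBelow-cong : ∀ m {z z′} → z ≈ z′ → chainsBelow m z ≈ᵣ chainsBelow m z′
  chainsBelow-cong zero    z≈z′ = refl
  chainsBelow-cong (suc m) {z} {z′} z≈z′ = Σ-cong elements (λ x → reflexive
    (≡.cong (λ b → [ b ] (Q^ rank x ⊗ chainsBelow m x))
      (does-⇔ (mk⇔ (⊑-respʳ-≈ z≈z′) (⊑-respʳ-≈ (Eq.sym z≈z′))) (x ≤? z) (x ≤? z′))))

  module _ (f : Carrier → K) (f-cong : ∀ {x y} → x ≈ y → f x ≈ᵣ f y) where

    at : ∀ z → Σ elements (λ x → [ does (x ≟ z) ] f x) ≈ᵣ f z
    at z = Σ-single (GradedPoset.setoid P) _≟_ f f-cong z unique (complete z)

    ⊑-reflexive : ∀ {x z} → x ≈ z → x ⊑ z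
    ⊑-reflexive x≈z = ⊑-respʳ-≈ x≈z ⊑-refl

    below-minimal : ∀ {z} → (∀ x → x ⊑ z → x ≈ z) → below f z ≈ᵣ f z
    below-minimal {z} minimal = trans (Σ-cong elements (λ x → reflexive (≡.cong (λ b → [ b ] f x)
      (does-⇔ (mk⇔ (minimal x) ⊑-reflexive) (x ≤? z) (x ≟ z))))) (at z)

    below-one : ∀ {z z₁} → z₁ ⊏ z → (∀ x → x ⊑ z → x ≈ z ⊎ x ⊑ z₁) → below f z ≈ᵣ below f z₁ ⊕ f z
    below-one {z} {z₁} (z₁⊑z , z₁≉z) cover = begin
      below f z
        ≈⟨ Σ-cong elements pointwise ⟩
      Σ elements (λ x → [ does (x ≤? z₁) ] f x ⊕ [ does (x ≟ z) ] f x)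
        ≈⟨ trans (Σ-⊕ elements _ _) (+-congˡ (at z)) ⟩
      below f z₁ ⊕ f z ∎
      where
      pointwise : ∀ x → [ does (x ≤? z) ] f x ≈ᵣ [ does (x ≤? z₁) ] f x ⊕ [ does (x ≟ z) ] f x
      pointwise x with x ≤? z | x ≤? z₁ | x ≟ z
      ... | yes _   | yes _    | no _    = sym (+-identityʳ _)
      ... | yes _   | no _     | yes _   = sym (+-identityˡ _)
      ... | no _    | no _     | no _    = sym (+-identityʳ _)
      ... | _       | yes x⊑z₁ | yes x≈z = contradiction
        (antisym z₁⊑z (⊑-respˡ-≈ x≈z x⊑z₁)) z₁≉z
      ... | yes x⊑z | no x⋢z₁  | no x≉z  with cover x x⊑z
      ...   | inj₁ x≈z  = contradiction x≈z x≉z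
      ...   | inj₂ x⊑z₁ = contradiction x⊑z₁ x⋢z₁
      pointwise x | no x⋢z | yes x⊑z₁ | no _    = contradiction (⊑-trans x⊑z₁ z₁⊑z) x⋢z
      pointwise x | no x⋢z | no _     | yes x≈z = contradiction (⊑-reflexive x≈z) x⋢z

    -- Holds for each `x` separately. An `x` below both covers is counted twice on the right; on the
    -- left it is counted once below `z` and, by `meet`, once below `z₃`. The element `z` itself
    -- lies below neither cover.
    below-two : ∀ {z z₁ z₂ z₃} → z₁ ⊏ z → z₂ ⊏ z → z₃ ⊑ z₁ → z₃ ⊑ z₂ →
      (∀ x → x ⊑ z₁ → x ⊑ z₂ → x ⊑ z₃) → (∀ x → x ⊑ z → x ≈ z ⊎ x ⊑ z₁ ⊎ x ⊑ z₂) →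
      below f z ⊕ below f z₃ ≈ᵣ (below f z₁ ⊕ below f z₂) ⊕ f z
    below-two {z} {z₁} {z₂} {z₃} (z₁⊑z , z₁≉z) (z₂⊑z , z₂≉z) z₃⊑z₁ z₃⊑z₂ meet cover = begin
      below f z ⊕ below f z₃
        ≈⟨ Σ-⊕ elements _ _ ⟨
      Σ elements (λ x → [ does (x ≤? z) ] f x ⊕ [ does (x ≤? z₃) ] f x)
        ≈⟨ Σ-cong elements pointwise ⟩
      Σ elements (λ x → ([ does (x ≤? z₁) ] f x ⊕ [ does (x ≤? z₂) ] f x) ⊕ [ does (x ≟ z) ] f x)
        ≈⟨ trans (Σ-⊕ elements _ _) (+-cong (Σ-⊕ elements _ _) (at z)) ⟩
      (below f z₁ ⊕ below f z₂) ⊕ f z ∎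
      where
      outside : ∀ {x} → ¬ x ≈ z → ¬ x ⊑ z₁ → ¬ x ⊑ z₂ → ¬ (x ≈ z ⊎ x ⊑ z₁ ⊎ x ⊑ z₂)
      outside x≉z x⋢z₁ x⋢z₂ (inj₁ x≈z)         = x≉z x≈z
      outside x≉z x⋢z₁ x⋢z₂ (inj₂ (inj₁ x⊑z₁)) = x⋢z₁ x⊑z₁
      outside x≉z x⋢z₁ x⋢z₂ (inj₂ (inj₂ x⊑z₂)) = x⋢z₂ x⊑z₂
      pointwise : ∀ x → [ does (x ≤? z) ] f x ⊕ [ does (x ≤? z₃) ] f x
        ≈ᵣ ([ does (x ≤? z₁) ] f x ⊕ [ does (x ≤? z₂) ] f x) ⊕ [ does (x ≟ z) ] f x
      pointwise x with x ≟ z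
      ... | yes x≈z
        rewrite dec-true (x ≤? z) (⊑-reflexive x≈z)
              | dec-false (x ≤? z₁) (λ x⊑z₁ → z₁≉z (antisym z₁⊑z (⊑-respˡ-≈ x≈z x⊑z₁)))
              | dec-false (x ≤? z₂) (λ x⊑z₂ → z₂≉z (antisym z₂⊑z (⊑-respˡ-≈ x≈z x⊑z₂)))
              | dec-false (x ≤? z₃) (λ x⊑z₃ → z₁≉z (antisym z₁⊑z (⊑-respˡ-≈ x≈z (⊑-trans x⊑z₃ z₃⊑z₁))))
        = trans (+-identityʳ _) (sym (trans (+-congʳ (+-identityˡ 0#)) (+-identityˡ _)))
      ... | no x≉z with x ≤? z₁ | x ≤? z₂
      ...   | yes x⊑z₁ | yes x⊑z₂
        rewrite dec-true (x ≤? z) (⊑-trans x⊑z₁ z₁⊑z) | dec-true (x ≤? z₃) (meet x x⊑z₁ x⊑z₂)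
        = sym (+-identityʳ _)
      ...   | yes x⊑z₁ | no x⋢z₂
        rewrite dec-true (x ≤? z) (⊑-trans x⊑z₁ z₁⊑z) | dec-false (x ≤? z₃) (λ x⊑z₃ → x⋢z₂ (⊑-trans x⊑z₃ z₃⊑z₂))
        = sym (+-identityʳ _)
      ...   | no x⋢z₁ | yes x⊑z₂
        rewrite dec-true (x ≤? z) (⊑-trans x⊑z₂ z₂⊑z) | dec-false (x ≤? z₃) (λ x⊑z₃ → x⋢z₁ (⊑-trans x⊑z₃ z₃⊑z₁))
        = trans (+-comm _ _) (sym (+-identityʳ _))
      ...   | no x⋢z₁ | no x⋢z₂
        rewrite dec-false (x ≤? z₃) (λ x⊑z₃ → x⋢z₁ (⊑-trans x⊑z₃ z₃⊑z₁))
              | dec-false (x ≤? z) (λ x⊑z → outside x≉z x⋢z₁ x⋢z₂ (cover x x⊑z))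
        = sym (+-identityʳ _)

  Q^_t : ℕ → Series
  Q^ n t = const (Q^ n) ⊠ var^ 1

  q^t-⊠-zero : ∀ n f → (Q^ n t ⊠ f) 0 ≈ᵣ 0#
  q^t-⊠-zero n f = trans (⊠-assoc (const (Q^ n)) (var^ 1) f 0)
    (trans (const-⊠ (Q^ n) (var^ 1 ⊠ f) 0) (trans (*-congˡ (var^suc-⊠-zero 0 f)) (zeroʳ _)))

  q^t-⊠-suc : ∀ n f m → (Q^ n t ⊠ f) (suc m) ≈ᵣ Q^ n ⊗ f m
  q^t-⊠-suc n f m = trans (⊠-assoc (const (Q^ n)) (var^ 1) f (suc m))
    (trans (const-⊠ (Q^ n) (var^ 1 ⊠ f) (suc m)) (*-congˡ (trans (var^suc-⊠-suc 0 f m) (var^0-⊠ f m))))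

  F : Carrier → Series
  F z m = chainsBelow m z

  private
    term-cong : ∀ m {x y} → x ≈ y → Q^ rank x ⊗ chainsBelow m x ≈ᵣ Q^ rank y ⊗ chainsBelow m y
    term-cong m x≈y = *-cong (reflexive (≡.cong Q^_ (rank-cong x≈y))) (chainsBelow-cong m x≈y)

  -- For this and the next two lemmas: the coefficient of t^(m+1) in `F z` is `below` applied to the
  -- summand `Q^ rank x ⊗ chainsBelow m x`, whose value at `z` is the coefficient contributed by
  -- `Q^ rank z t ⊠ F z`. In degree 0 only empty chains are counted.
  F-minimal : ∀ {z} → (∀ x → x ⊑ z → x ≈ z) → F z ≋ₛ 1ₛ ⊞ Q^ rank z t ⊠ F z
  F-minimal {z} minimal zero    = sym (trans (+-congˡ (q^t-⊠-zero (rank z) (F z))) (+-identityʳ _))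
  F-minimal {z} minimal (suc m) = trans (below-minimal _ (term-cong m) minimal)
    (sym (trans (+-identityˡ _) (q^t-⊠-suc (rank z) (F z) m)))

  F-one : ∀ {z z₁} → z₁ ⊏ z → (∀ x → x ⊑ z → x ≈ z ⊎ x ⊑ z₁) → F z ≋ₛ F z₁ ⊞ Q^ rank z t ⊠ F z
  F-one {z} z₁⊏z cover zero    = sym (trans (+-congˡ (q^t-⊠-zero (rank z) (F z))) (+-identityʳ _))
  F-one {z} z₁⊏z cover (suc m) = trans (below-one _ (term-cong m) z₁⊏z cover)
    (+-congˡ (sym (q^t-⊠-suc (rank z) (F z) m)))

  F-two : ∀ {z z₁ z₂ z₃} → z₁ ⊏ z → z₂ ⊏ z → z₃ ⊑ z₁ → z₃ ⊑ z₂ →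
    (∀ x → x ⊑ z₁ → x ⊑ z₂ → x ⊑ z₃) → (∀ x → x ⊑ z → x ≈ z ⊎ x ⊑ z₁ ⊎ x ⊑ z₂) →
    F z ⊞ F z₃ ≋ₛ (F z₁ ⊞ F z₂) ⊞ Q^ rank z t ⊠ F z
  F-two {z} _ _ _ _ _ _ zero = sym (trans (+-congˡ (q^t-⊠-zero (rank z) (F z))) (+-identityʳ _))
  F-two {z} z₁⊏z z₂⊏z z₃⊑z₁ z₃⊑z₂ meet cover (suc m) =
    trans (below-two _ (term-cong m) z₁⊏z z₂⊏z z₃⊑z₁ z₃⊑z₂ meet cover)
      (+-congˡ (sym (q^t-⊠-suc (rank z) (F z) m)))

-- The region b ≤ a + e

-- What the recursion needs of an interval: an order embedding into the plane with rank `p + w`,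
-- whose image lies in the region b ≤ a + e and contains every point of that region below one of its
-- own.
record RegionCoordinates (P : GradedPoset) (e : ℕ) : Set where
  open GradedPoset P
  field
    p w        : Carrier → ℕ
    monotone   : ∀ {x z} → x ⊑ z → p x ≤ p z × w x ≤ w z
    reflecting : ∀ {x z} → p x ≤ p z → w x ≤ w z → x ⊑ z
    bounded    : ∀ z → w z ≤ p z + e
    rank≡      : ∀ z → rank z ≡ p z + w z
    cell       : ∀ z {a b} → a ≤ p z → b ≤ w z → b ≤ a + e → ∃ λ z′ → p z′ ≡ a × w z′ ≡ b

module Region {c ℓ : Level} (R : CommutativeRing c ℓ) (powers : QPowers R)
  (P : GradedPoset) (e : ℕ) (coordinates : RegionCoordinates P e) where
  open CommutativeRing R hiding (zero; rawRing; setoid; _-_)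
    renaming (Carrier to K; _+_ to _⊕_; _*_ to _⊗_; _≈_ to _≈ᵣ_)
  open GradedPoset P
  open RegionCoordinates coordinates
  open DecPoset decPoset using (antisym; module Eq)
  open PosetSeries R powers P public
  open GaussianPolynomials R powers
  open OneBoundary e
  open PowerSeries (CommutativeRing.rawRing R) using (Series)
  open PowerSeriesProperties R using (_≋ₛ_; _⊞_; _⊠_; 1ₛ; commutativeRing; ⊠-cong; ⊠-identityˡ)
  open Ring (PowerSeries.rawRing (CommutativeRing.rawRing R)) using (∏; _-_)
  module SeriesRing = CommutativeRing commutativeRing
  open Products commutativeRing
  open GeometricFactors commutativeRing
  open RingProperties SeriesRing.ring using () renaming (+-cancelʳ to ⊞-cancelʳ)

  D : ℕ → Series
  D n = ∏ {n} (λ a → 1ₛ - Q^ toℕ a t)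

  D-last : ∀ n → D (suc n) ≋ₛ D n ⊠ (1ₛ - Q^ n t)
  D-last n = Π-last n (λ a → 1ₛ - Q^ a t)

  -- The denominator stops at the rank of `z`, so this is the numerator of the order ideal below
  -- `z`, and at `top` that of the whole poset.
  N : Carrier → Series
  N z = F z ⊠ D (suc (rank z))

  N-minimal : ∀ {z} → rank z ≡ 0 → (∀ x → x ⊑ z → x ≈ z) → N z ≋ₛ 1ₛ
  N-minimal {z} rank≡0 minimal = SeriesRing.trans {N z} {1ₛ ⊠ D (rank z)} {1ₛ}
    (clear-one {F z} {1ₛ} {Q^ rank z t} {D (rank z)} {D (suc (rank z))} (D-last (rank z)) (F-minimal minimal))
    (SeriesRing.trans {1ₛ ⊠ D (rank z)} {D (rank z)} {1ₛ} (⊠-identityˡ (D (rank z))) (D≋1 rank≡0))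
    where
    D≋1 : ∀ {n} → n ≡ 0 → D n ≋ₛ 1ₛ
    D≋1 ≡.refl = SeriesRing.refl {1ₛ}

  N-one : ∀ {z z₁} → rank z ≡ suc (rank z₁) → z₁ ⊏ z → (∀ x → x ⊑ z → x ≈ z ⊎ x ⊑ z₁) → N z ≋ₛ N z₁
  N-one {z} {z₁} rank≡ z₁⊏z cover = SeriesRing.trans {N z} {F z₁ ⊠ D (rank z)} {N z₁}
    (clear-one {F z} {F z₁} {Q^ rank z t} {D (rank z)} {D (suc (rank z))} (D-last (rank z)) (F-one z₁⊏z cover))
    (SeriesRing.reflexive (≡.cong (λ n → F z₁ ⊠ D n) rank≡))

  N-two : ∀ {n z z₁ z₂ z₃} → rank z ≡ suc (suc n) → rank z₁ ≡ suc n → rank z₂ ≡ suc n → rank z₃ ≡ n →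
    z₁ ⊏ z → z₂ ⊏ z → z₃ ⊑ z₁ → z₃ ⊑ z₂ →
    (∀ x → x ⊑ z₁ → x ⊑ z₂ → x ⊑ z₃) → (∀ x → x ⊑ z → x ≈ z ⊎ x ⊑ z₁ ⊎ x ⊑ z₂) →
    N z ⊞ N z₃ ≋ₛ (N z₁ ⊞ N z₂) ⊞ Q^ (suc n) t ⊠ N z₃
  N-two {n} {z} {z₁} {z₂} {z₃} r r₁ r₂ r₃ z₁⊏z z₂⊏z z₃⊑z₁ z₃⊑z₂ meet cover rewrite r | r₁ | r₂ | r₃ =
    clear-two {F z} {F z₁} {F z₂} {F z₃} {Q^ (suc (suc n)) t} {Q^ (suc n) t} {D (suc n)} {D (suc (suc n))} {D (suc (suc (suc n)))}
      (D-last (suc (suc n))) (D-last (suc n)) F-equation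
    where
    F-equation : F z ⊞ F z₃ ≋ₛ (F z₁ ⊞ F z₂) ⊞ Q^ (suc (suc n)) t ⊠ F z
    F-equation = ≡.subst (λ k → F z ⊞ F z₃ ≋ₛ (F z₁ ⊞ F z₂) ⊞ Q^ k t ⊠ F z) r
      (F-two z₁⊏z z₂⊏z z₃⊑z₁ z₃⊑z₂ meet cover)

  private
    coordinates-≡ : ∀ {x z} → x ≈ z → p x ≡ p z × w x ≡ w z
    coordinates-≡ x≈z =
      ℕ.≤-antisym (proj₁ (monotone x⊑z)) (proj₁ (monotone z⊑x)) , ℕ.≤-antisym (proj₂ (monotone x⊑z)) (proj₂ (monotone z⊑x))
      where
      x⊑z = ⊑-respʳ-≈ x≈z ⊑-refl
      z⊑x = ⊑-respʳ-≈ (Eq.sym x≈z) ⊑-refl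

    shift-series : ∀ n a b ν → (Q^ n t ⊠ φ a b) ν ≈ᵣ shift n (φ a b) ν
    shift-series n a b zero    = q^t-⊠-zero n (φ a b)
    shift-series n a b (suc ν) = q^t-⊠-suc n (φ a b) ν

    -- By `extreme`, an element below `z` with the same `w` is `z` itself, so all others lie below
    -- the cell one step down in `w`. This serves both the axis `p z ≡ 0` and the slanted line.
    one-cover : ∀ {z b} → w z ≡ suc b → b ≤ p z + e → (∀ x → x ⊑ z → w x ≡ w z → p z ≤ p x) →
      ∃ λ z₁ → p z₁ ≡ p z × w z₁ ≡ b × N z ≋ₛ N z₁
    one-cover {z} {b} wz b≤ extreme = z₁ , p₁ , w₁ , N-one
      (≡.trans (rank≡ z) (≡.trans (≡.cong₂ _+_ (≡.sym p₁) (≡.trans wz (≡.cong suc (≡.sym w₁))))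
        (≡.trans (ℕ.+-suc (p z₁) (w z₁)) (≡.cong suc (≡.sym (rank≡ z₁))))))
      ((reflecting (ℕ.≤-reflexive p₁) (ℕ.≤-trans (ℕ.≤-reflexive w₁) b≤wz))
        , λ z₁≈z → ℕ.1+n≢n (≡.sym (≡.trans (≡.sym w₁) (≡.trans (proj₂ (coordinates-≡ z₁≈z)) wz))))
      cover
      where
      b≤wz : b ≤ w z
      b≤wz = ℕ.≤-trans (ℕ.n≤1+n b) (ℕ.≤-reflexive (≡.sym wz))
      below-z = cell z ℕ.≤-refl b≤wz b≤
      z₁ = proj₁ below-z
      p₁ = proj₁ (proj₂ below-z)
      w₁ = proj₂ (proj₂ below-z)
      cover : ∀ x → x ⊑ z → x ≈ z ⊎ x ⊑ z₁
      cover x x⊑z with ℕ.m≤n⇒m<n∨m≡n (proj₂ (monotone x⊑z))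
      ... | inj₂ wx≡wz = inj₁ (antisym x⊑z (reflecting (extreme x x⊑z wx≡wz) (ℕ.≤-reflexive (≡.sym wx≡wz))))
      ... | inj₁ wx<wz = inj₂ (reflecting (ℕ.≤-trans (proj₁ (monotone x⊑z)) (ℕ.≤-reflexive (≡.sym p₁)))
              (ℕ.≤-trans (ℕ.≤-pred (ℕ.≤-trans wx<wz (ℕ.≤-reflexive wz))) (ℕ.≤-reflexive (≡.sym w₁))))

  numerator-φ : ∀ a b z → p z ≡ a → w z ≡ b → N z ≋ₛ φ a b
  numerator-φ zero zero z pz wz = SeriesRing.trans {N z} {1ₛ} {φ 0 0}
    (N-minimal (≡.trans (rank≡ z) (≡.cong₂ _+_ pz wz))
      (λ x x⊑z → antisym x⊑z (reflecting (ℕ.≤-trans (ℕ.≤-reflexive pz) z≤n) (ℕ.≤-trans (ℕ.≤-reflexive wz) z≤n))))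
    (λ { zero → sym (φ-bottomEdge 0 0) ; (suc ν) → sym (φ-bottomEdge 0 (suc ν)) })
  numerator-φ zero (suc b) z pz wz = SeriesRing.trans {N z} {N z₁} {φ 0 (suc b)} N≋
    (λ ν → trans (numerator-φ zero b z₁ (≡.trans p₁ pz) w₁ ν)
      (trans (φ-leftEdge (ℕ.<⇒≤ b<e) ν) (sym (φ-leftEdge b<e ν))))
    where
    b<e : suc b ≤ e
    b<e = ≡.subst₂ (λ a b → b ≤ a + e) pz wz (bounded z)
    predecessor = one-cover {z} wz (ℕ.≤-trans (ℕ.<⇒≤ b<e) (ℕ.m≤n+m e (p z)))
      (λ x _ _ → ℕ.≤-trans (ℕ.≤-reflexive pz) z≤n)
    z₁ = proj₁ predecessor
    p₁ = proj₁ (proj₂ predecessor)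
    w₁ = proj₁ (proj₂ (proj₂ predecessor))
    N≋ = proj₂ (proj₂ (proj₂ predecessor))
  numerator-φ (suc a) zero z pz wz = SeriesRing.trans {N z} {N z₁} {φ (suc a) 0}
    (N-one (≡.trans (rank≡ z) (≡.trans (≡.cong₂ _+_ pz wz) (≡.cong suc (≡.sym (≡.trans (rank≡ z₁) (≡.cong₂ _+_ p₁ w₁))))))
      ( reflecting (ℕ.≤-trans (ℕ.≤-reflexive p₁) a≤pz) (ℕ.≤-trans (ℕ.≤-reflexive w₁) z≤n)
      , λ z₁≈z → ℕ.1+n≢n (≡.sym (≡.trans (≡.sym p₁) (≡.trans (proj₁ (coordinates-≡ z₁≈z)) pz))))
      cover)
    (λ ν → trans (numerator-φ a zero z₁ p₁ w₁ ν) (trans (φ-bottomEdge a ν) (sym (φ-bottomEdge (suc a) ν))))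
    where
    a≤pz : a ≤ p z
    a≤pz = ℕ.≤-trans (ℕ.n≤1+n a) (ℕ.≤-reflexive (≡.sym pz))
    below-z = cell z a≤pz (z≤n {w z}) z≤n
    z₁ = proj₁ below-z
    p₁ = proj₁ (proj₂ below-z)
    w₁ = proj₂ (proj₂ below-z)
    cover : ∀ x → x ⊑ z → x ≈ z ⊎ x ⊑ z₁
    cover x x⊑z with ℕ.m≤n⇒m<n∨m≡n (proj₁ (monotone x⊑z))
    ... | inj₂ px≡pz = inj₁ (antisym x⊑z (reflecting (ℕ.≤-reflexive (≡.sym px≡pz)) (ℕ.≤-trans (ℕ.≤-reflexive wz) z≤n)))
    ... | inj₁ px<pz = inj₂ (reflecting
            (ℕ.≤-trans (ℕ.≤-pred (ℕ.≤-trans px<pz (ℕ.≤-reflexive pz))) (ℕ.≤-reflexive (≡.sym p₁)))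
            (ℕ.≤-trans (proj₂ (monotone x⊑z)) (ℕ.≤-trans (ℕ.≤-reflexive wz) z≤n)))
  numerator-φ (suc a) (suc b) z pz wz
    with ℕ.m≤n⇒m<n∨m≡n (ℕ.≤-pred (≡.subst₂ (λ a b → b ≤ a + e) pz wz (bounded z)))
  ... | inj₂ ≡.refl = SeriesRing.trans {N z} {N z₁} {φ (suc a) (suc (a + e))} N≋
    (λ ν → trans (numerator-φ (suc a) (a + e) z₁ (≡.trans p₁ pz) w₁ ν) (sym (φ-boundary a ν)))
    where
    predecessor = one-cover {z} wz (ℕ.≤-trans (ℕ.n≤1+n _) (ℕ.≤-reflexive (≡.cong (_+ e) (≡.sym pz))))
      -- On the line, suc (a + e) = w x ≤ p x + e forces suc a ≤ p x: the neighbour with smaller `p`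
      -- is outside the region.
      (λ x _ wx≡wz → ℕ.≤-trans (ℕ.≤-reflexive pz)
        (ℕ.+-cancelʳ-≤ e (suc a) (p x) (ℕ.≤-trans (ℕ.≤-reflexive (≡.sym (≡.trans wx≡wz wz))) (bounded x))))
    z₁ = proj₁ predecessor
    p₁ = proj₁ (proj₂ predecessor)
    w₁ = proj₁ (proj₂ (proj₂ predecessor))
    N≋ = proj₂ (proj₂ (proj₂ predecessor))
  ... | inj₁ b<a+e = ⊞-cancelʳ (φ a b) (N z) (φ (suc a) (suc b)) sum≋
    where
    a≤pz : a ≤ p z
    a≤pz = ℕ.≤-trans (ℕ.n≤1+n a) (ℕ.≤-reflexive (≡.sym pz))
    b≤wz : b ≤ w z
    b≤wz = ℕ.≤-trans (ℕ.n≤1+n b) (ℕ.≤-reflexive (≡.sym wz))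
    1+a≤pz : suc a ≤ p z
    1+a≤pz = ℕ.≤-reflexive (≡.sym pz)
    1+b≤wz : suc b ≤ w z
    1+b≤wz = ℕ.≤-reflexive (≡.sym wz)
    -- The strict inequality is what puts (a , suc b) into the region, so that there are two covers.
    cell₁ = cell z a≤pz 1+b≤wz b<a+e
    cell₂ = cell z 1+a≤pz b≤wz (ℕ.m≤n⇒m≤1+n (ℕ.<⇒≤ b<a+e))
    cell₃ = cell z a≤pz b≤wz (ℕ.<⇒≤ b<a+e)
    z₁ = proj₁ cell₁
    z₂ = proj₁ cell₂
    z₃ = proj₁ cell₃
    p₁ = proj₁ (proj₂ cell₁)
    w₁ = proj₂ (proj₂ cell₁)
    p₂ = proj₁ (proj₂ cell₂)
    w₂ = proj₂ (proj₂ cell₂)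
    p₃ = proj₁ (proj₂ cell₃)
    w₃ = proj₂ (proj₂ cell₃)
    infix 4 _⊑[_,_]
    _⊑[_,_] : Carrier → ℕ → ℕ → Set
    x ⊑[ i , j ] = p x ≤ i × w x ≤ j
    from : ∀ {x y i j} → p y ≡ i → w y ≡ j → x ⊑ y → x ⊑[ i , j ]
    from ≡.refl ≡.refl = monotone
    to : ∀ {x y i j} → p y ≡ i → w y ≡ j → p x ≤ i → w x ≤ j → x ⊑ y
    to ≡.refl ≡.refl = reflecting
    cover : ∀ x → x ⊑ z → x ≈ z ⊎ x ⊑ z₁ ⊎ x ⊑ z₂
    cover x x⊑z with from pz wz x⊑z
    ... | px≤ , wx≤ with ℕ.m≤n⇒m<n∨m≡n px≤ | ℕ.m≤n⇒m<n∨m≡n wx≤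
    ...   | inj₁ px< | _        = inj₂ (inj₁ (to p₁ w₁ (ℕ.≤-pred px<) wx≤))
    ...   | inj₂ _   | inj₁ wx< = inj₂ (inj₂ (to p₂ w₂ px≤ (ℕ.≤-pred wx<)))
    ...   | inj₂ px≡ | inj₂ wx≡ = inj₁ (antisym x⊑z (to px≡ wx≡ (ℕ.≤-reflexive pz) (ℕ.≤-reflexive wz)))
    rank-of : ∀ {y i j} → p y ≡ i → w y ≡ j → rank y ≡ i + j
    rank-of {y} ≡.refl ≡.refl = rank≡ y
    N-equation : N z ⊞ N z₃ ≋ₛ (N z₁ ⊞ N z₂) ⊞ Q^ (suc (a + b)) t ⊠ N z₃
    N-equation = N-two {a + b} {z} {z₁} {z₂} {z₃}
      (≡.trans (rank-of pz wz) (≡.cong suc (ℕ.+-suc a b)))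
      (≡.trans (rank-of p₁ w₁) (ℕ.+-suc a b)) (rank-of p₂ w₂) (rank-of p₃ w₃)
      ( to pz wz (ℕ.≤-trans (ℕ.≤-reflexive p₁) (ℕ.n≤1+n a)) (ℕ.≤-reflexive w₁)
      , λ z₁≈z → ℕ.1+n≢n (≡.sym (≡.trans (≡.sym p₁) (≡.trans (proj₁ (coordinates-≡ z₁≈z)) pz))))
      ( to pz wz (ℕ.≤-reflexive p₂) (ℕ.≤-trans (ℕ.≤-reflexive w₂) (ℕ.n≤1+n b))
      , λ z₂≈z → ℕ.1+n≢n (≡.sym (≡.trans (≡.sym w₂) (≡.trans (proj₂ (coordinates-≡ z₂≈z)) wz))))
      (to p₁ w₁ (ℕ.≤-reflexive p₃) (ℕ.≤-trans (ℕ.≤-reflexive w₃) (ℕ.n≤1+n b)))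
      (to p₂ w₂ (ℕ.≤-trans (ℕ.≤-reflexive p₃) (ℕ.n≤1+n a)) (ℕ.≤-reflexive w₃))
      (λ x x⊑z₁ x⊑z₂ → to p₃ w₃ (proj₁ (from p₁ w₁ x⊑z₁)) (proj₂ (from p₂ w₂ x⊑z₂)))
      cover
    N₁≋ : N z₁ ≋ₛ φ a (suc b)
    N₁≋ = numerator-φ a (suc b) z₁ p₁ w₁
    N₂≋ : N z₂ ≋ₛ φ (suc a) b
    N₂≋ = numerator-φ (suc a) b z₂ p₂ w₂
    N₃≋ : N z₃ ≋ₛ φ a b
    N₃≋ = numerator-φ a b z₃ p₃ w₃
    -- Strictly inside the region a + e exceeds b, so the index a + e - 1 of the reflected term is
    -- not truncated, as `φ-recurrence` requires.
    positive : ∃ λ M → a + e ≡ suc M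
    positive = let (o , eq) = ℕ.m≤n⇒∃[o]m+o≡n b<a+e in b + o , ≡.sym eq
    sum≋ : N z ⊞ φ a b ≋ₛ φ (suc a) (suc b) ⊞ φ a b
    sum≋ ν = trans (+-congˡ (sym (N₃≋ ν))) (trans (N-equation ν)
      (trans (+-cong (+-cong (N₁≋ ν) (N₂≋ ν))
                     (trans (⊠-cong {Q^ (suc (a + b)) t} {Q^ (suc (a + b)) t} {N z₃} {φ a b} (λ _ → refl) N₃≋ ν)
                            (shift-series (suc (a + b)) a b ν)))
             (sym (φ-recurrence {a} {b} (proj₂ positive) ν))))

-- Polynomials with integer coefficients

module ℤ⟦q⟧-Properties = PowerSeriesProperties ℤ.+-*-commutativeRing

ℤ⟦q⟧-ring : CommutativeRing _ _
ℤ⟦q⟧-ring = ℤ⟦q⟧-Properties.commutativeRing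

open ≡ using (refl; sym; trans; cong; cong₂; module ≡-Reasoning)
open CommutativeRing ℤ⟦q⟧-ring using () renaming (_*_ to _⊗_; _≈_ to _≈ᵣ_)

ℤ⟦q⟧-powers : QPowers ℤ⟦q⟧-ring
ℤ⟦q⟧-powers = record
  { Q^_            = q^_
  ; 1/1-Q^_        = Q.1/1-var^
  ; q^-zero        = ℤ⟦q⟧-Properties.var^-zero
  ; q^-+           = ℤ⟦q⟧-Properties.var^-+
  ; 1/1-q^-inverse = ℤ⟦q⟧-Properties.1/1-var^-inverse
  }

module Gaussian = GaussianPolynomials ℤ⟦q⟧-ring ℤ⟦q⟧-powers

-- Integer and truncated indices of Gaussian binomials

module _ (e : ℕ) where
  open Gaussian.OneBoundary e

  gaussian-S : ∀ b ν → gaussian (+ b ℤ.- + e ℤ.+ 1ℤ) (+ ν ℤ.+ 1ℤ) ≡ S b ν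
  gaussian-S b ν = ≡.trans
    (≡.cong₂ gaussian
      (≡.trans (≡.cong (ℤ._+ 1ℤ) (ℤ.m-n≡m⊖n b e))
        (≡.trans (ℤ.distribˡ-⊖-+-pos 1 b e) (≡.cong (ℤ._⊖ e) (ℕ.+-comm b 1))))
      (≡.cong +_ (ℕ.+-comm ν 1)))
    (truncated (ℕ.≤-<-connex e (suc b)))
    where
    truncated : e ≤ suc b ⊎ suc b < e → gaussian (suc b ℤ.⊖ e) (+ suc ν) ≡ S b ν
    truncated (inj₁ e≤1+b) = ≡.cong (λ n → gaussian n (+ suc ν)) (ℤ.⊖-≥ e≤1+b)
    -- Splitting on the difference exposes the index as a negative integer, where `gaussian` is 0 by
    -- its last clause; the truncated side is [0, ν+1] = 0.
    truncated (inj₂ 1+b<e) with e ∸ suc b | ℕ.m<n⇒0<n∸m 1+b<e | ℤ.⊖-< 1+b<e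
    ... | suc _ | _ | eq = ≡.trans (≡.cong (λ n → gaussian n (+ suc ν)) eq)
                                   (≡.cong (λ n → Gaussian.G n (suc ν)) (≡.sym (ℕ.m≤n⇒m∸n≡0 (ℕ.<⇒≤ 1+b<e))))

  gaussian-C-zero : ∀ a → gaussian (+ a ℤ.+ + e ℤ.- 1ℤ) (+ 0 ℤ.- 1ℤ) ≡ C a 0
  gaussian-C-zero a with a + e
  ... | zero  = ≡.refl
  ... | suc _ = ≡.refl

  gaussian-C-suc : ∀ a {M} k → a + e ≡ suc M → gaussian (+ a ℤ.+ + e ℤ.- 1ℤ) (+ suc k ℤ.- 1ℤ) ≡ C a (suc k)
  gaussian-C-suc a k eq with a + e
  gaussian-C-suc a k ≡.refl | suc _ = ≡.refl

  module Qᵣ = CommutativeRing ℤ⟦q⟧-ring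

  -- Stated for the product, since for a = e = 0 and ν = 1 the second factors differ: the integer
  -- index -1 gives 0, the truncated index gives [0, 0] = 1.
  gaussian-SC : ∀ a b ν → b ≤ a + e →
    gaussian (+ b ℤ.- + e ℤ.+ 1ℤ) (+ ν ℤ.+ 1ℤ) ⊗ gaussian (+ a ℤ.+ + e ℤ.- 1ℤ) (+ ν ℤ.- 1ℤ) ≈ᵣ S b ν ⊗ C a ν
  gaussian-SC a b zero    b≤a+e = Qᵣ.reflexive (≡.cong₂ _⊗_ (gaussian-S b 0) (gaussian-C-zero a))
  gaussian-SC a b (suc k) b≤a+e = cases (a + e) ≡.refl
    where
    γ = gaussian (+ a ℤ.+ + e ℤ.- 1ℤ) (+ suc k ℤ.- 1ℤ)
    cases : ∀ n → a + e ≡ n → gaussian (+ b ℤ.- + e ℤ.+ 1ℤ) (+ suc k ℤ.+ 1ℤ) ⊗ γ ≈ᵣ S b (suc k) ⊗ C a (suc k)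
    cases (suc M) a+e≡ = Qᵣ.reflexive (≡.cong₂ _⊗_ (gaussian-S b (suc k)) (gaussian-C-suc a k a+e≡))
    -- Here b ≤ a + e = 0, so `S b (suc k)` has upper index at most 1 and lower index at least 2.
    cases zero    a+e≡ = Qᵣ.trans {gaussian (+ b ℤ.- + e ℤ.+ 1ℤ) (+ suc k ℤ.+ 1ℤ) ⊗ γ} {Qᵣ.0# ⊗ γ} {S b (suc k) ⊗ C a (suc k)}
      (Qᵣ.reflexive (≡.cong (_⊗ γ) (≡.trans (gaussian-S b (suc k)) S≡0)))
      (Qᵣ.trans {Qᵣ.0# ⊗ γ} {Qᵣ.0#} {S b (suc k) ⊗ C a (suc k)} (Qᵣ.zeroˡ γ)
        (Qᵣ.sym {S b (suc k) ⊗ C a (suc k)} {Qᵣ.0#} (Qᵣ.trans {S b (suc k) ⊗ C a (suc k)} {Qᵣ.0# ⊗ C a (suc k)} {Qᵣ.0#}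
          (Qᵣ.reflexive (≡.cong (_⊗ C a (suc k)) S≡0)) (Qᵣ.zeroˡ (C a (suc k))))))
      where
      S≡0 : S b (suc k) ≡ Qᵣ.0#
      S≡0 = Gaussian.G-zero (s≤s (ℕ.≤-trans (ℕ.m∸n≤m (suc b) e)
        (s≤s (ℕ.≤-trans b≤a+e (ℕ.≤-trans (ℕ.≤-reflexive a+e≡) z≤n)))))

  Φ-φ : ∀ a b → b ≤ a + e → φ a b ≋ Φ a b e
  Φ-φ a b b≤a+e ν = Qᵣ.trans {φ a b ν} {q^ (ν * ν) ⊗ (g Qᵣ.- q^ e ⊗ (S b ν ⊗ C a ν))} {Φ a b e ν}
    (φ-factored a b ν)
    (Qᵣ.*-cong {q^ (ν * ν)} {q^ (ν * ν)} {g Qᵣ.- q^ e ⊗ (S b ν ⊗ C a ν)} {g Qᵣ.- q^ e ⊗ sc}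
      (λ _ → ≡.refl)
      (Qᵣ.+-cong {g} {g} {Qᵣ.- (q^ e ⊗ (S b ν ⊗ C a ν))} {Qᵣ.- (q^ e ⊗ sc)} (λ _ → ≡.refl)
        (Qᵣ.-‿cong {q^ e ⊗ (S b ν ⊗ C a ν)} {q^ e ⊗ sc}
          (Qᵣ.*-cong {q^ e} {q^ e} {S b ν ⊗ C a ν} {sc} (λ _ → ≡.refl)
            (Qᵣ.sym {sc} {S b ν ⊗ C a ν} (gaussian-SC a b ν b≤a+e))))))
    where
    g sc : ℤ⟦q⟧
    g  = gaussian (+ a) (+ ν) ⊗ gaussian (+ b) (+ ν)
    sc = gaussian (+ b ℤ.- + e ℤ.+ 1ℤ) (+ ν ℤ.+ 1ℤ) ⊗ gaussian (+ a ℤ.+ + e ℤ.- 1ℤ) (+ ν ℤ.- 1ℤ)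

-- Arithmetic of coefficient lists

module _ {A : Set} where

  merge : (A → A → A) → List A → List A → List A
  merge _∙_ []       ys       = ys
  merge _∙_ (x ∷ xs) []       = x ∷ xs
  merge _∙_ (x ∷ xs) (y ∷ ys) = (x ∙ y) ∷ merge _∙_ xs ys

  coefficient-merge : ∀ {_∙_ : A → A → A} {z} → (∀ x → z ∙ x ≡ x) → (∀ x → x ∙ z ≡ x) → ∀ xs ys n →
    coefficient z (merge _∙_ xs ys) n ≡ (coefficient z xs n ∙ coefficient z ys n)
  coefficient-merge idˡ idʳ []       ys       n       = sym (idˡ _)
  coefficient-merge idˡ idʳ (x ∷ xs) []       n       = sym (idʳ _)
  coefficient-merge idˡ idʳ (x ∷ xs) (y ∷ ys) zero    = refl
  coefficient-merge idˡ idʳ (x ∷ xs) (y ∷ ys) (suc n) = coefficient-merge idˡ idʳ xs ys n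

  coefficient-map : ∀ (f : A → A) {z} → f z ≡ z → ∀ xs n → coefficient z (map f xs) n ≡ f (coefficient z xs n)
  coefficient-map f fz≡z []       n       = sym fz≡z
  coefficient-map f fz≡z (x ∷ xs) zero    = refl
  coefficient-map f fz≡z (x ∷ xs) (suc n) = coefficient-map f fz≡z xs n

  -- Horner's scheme at 1, in the form to which evaluate reduces.
  total : (A → ℤ) → List A → ℤ
  total v = foldr (λ x rest → v x ℤ.+ 1ℤ ℤ.* rest) 0ℤ

  module _ (v : A → ℤ) where

    total-merge : ∀ {_∙_} → (∀ x y → v (x ∙ y) ≡ v x ℤ.+ v y) →
      ∀ xs ys → total v (merge _∙_ xs ys) ≡ total v xs ℤ.+ total v ys
    total-merge v-∙ []       ys       = sym (ℤ.+-identityˡ _)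
    total-merge v-∙ (x ∷ xs) []       = sym (ℤ.+-identityʳ _)
    total-merge v-∙ (x ∷ xs) (y ∷ ys) = trans (cong₂ (λ a b → a ℤ.+ 1ℤ ℤ.* b) (v-∙ x y) (total-merge v-∙ xs ys))
                                              (rearrange (v x) (v y) (total v xs) (total v ys))
      where
      rearrange : ∀ a b c d → (a ℤ.+ b) ℤ.+ 1ℤ ℤ.* (c ℤ.+ d) ≡ (a ℤ.+ 1ℤ ℤ.* c) ℤ.+ (b ℤ.+ 1ℤ ℤ.* d)
      rearrange = solve-∀

    total-map-neg : ∀ {f} → (∀ x → v (f x) ≡ ℤ.- v x) → ∀ xs → total v (map f xs) ≡ ℤ.- total v xs
    total-map-neg v-f []       = refl
    total-map-neg v-f (x ∷ xs) = trans (cong₂ (λ a b → a ℤ.+ 1ℤ ℤ.* b) (v-f x) (total-map-neg v-f xs))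
                                       (rearrange (v x) (total v xs))
      where
      rearrange : ∀ a b → (ℤ.- a) ℤ.+ 1ℤ ℤ.* (ℤ.- b) ≡ ℤ.- (a ℤ.+ 1ℤ ℤ.* b)
      rearrange = solve-∀

    total-map : ∀ {f} → (∀ x → v (f x) ≡ v x) → ∀ xs → total v (map f xs) ≡ total v xs
    total-map v-f []       = refl
    total-map v-f (x ∷ xs) = cong₂ (λ a b → a ℤ.+ 1ℤ ℤ.* b) (v-f x) (total-map v-f xs)

    total-prepend : ∀ {z} → v z ≡ 0ℤ → ∀ xs → total v (z ∷ xs) ≡ total v xs
    total-prepend vz≡0 xs = trans (cong (ℤ._+ (1ℤ ℤ.* total v xs)) vz≡0) (trans (ℤ.+-identityˡ _) (ℤ.*-identityˡ _))

    -- Trailing entries beyond the shorter list have the same value as the padding `z`, namely 0.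
    -- Coefficients are compared only through `v`, because at the outer level they are lists that
    -- may themselves differ by trailing zeros.
    total-ext : ∀ {z} → v z ≡ 0ℤ → ∀ xs ys → (∀ n → v (coefficient z xs n) ≡ v (coefficient z ys n)) →
      total v xs ≡ total v ys
    total-ext vz≡0 []       []       eq = refl
    total-ext vz≡0 []       (y ∷ ys) eq = sym (trans (cong₂ (λ a b → a ℤ.+ 1ℤ ℤ.* b) (trans (sym (eq 0)) vz≡0)
                                                      (sym (total-ext vz≡0 [] ys (eq ∘ suc)))) refl)
    total-ext vz≡0 (x ∷ xs) []       eq = trans (cong₂ (λ a b → a ℤ.+ 1ℤ ℤ.* b) (trans (eq 0) vz≡0)
                                                 (total-ext vz≡0 xs [] (eq ∘ suc))) refl
    total-ext vz≡0 (x ∷ xs) (y ∷ ys) eq = cong₂ (λ a b → a ℤ.+ 1ℤ ℤ.* b) (eq 0) (total-ext vz≡0 xs ys (eq ∘ suc))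

total₁ : List ℤ → ℤ
total₁ = total id

evaluate-cong : ∀ g h → ⟦ g ⟧ ≋ ⟦ h ⟧ → evaluate g 1ℤ 1ℤ ≡ evaluate h 1ℤ 1ℤ
evaluate-cong g h g≋h = total-ext total₁ {[]} refl g h
  (λ n → total-ext id {0ℤ} refl (coefficient [] g n) (coefficient [] h n) (g≋h n))

infixl 6 _⟨+⟩_
_⟨+⟩_ : ℤ[q,t] → ℤ[q,t] → ℤ[q,t]
_⟨+⟩_ = merge (merge ℤ._+_)

⟨-⟩_ : ℤ[q,t] → ℤ[q,t]
⟨-⟩_ = map (map (ℤ.-_))

q^_t·_ : ℕ → ℤ[q,t] → ℤ[q,t]
q^ n t· h = [] ∷ map (replicate n 0ℤ ++_) h

merge-identityʳ : ∀ (f : List ℤ) → merge ℤ._+_ f [] ≡ f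
merge-identityʳ []      = refl
merge-identityʳ (_ ∷ _) = refl

⟦⟧-+ : ∀ g h n k → ⟦ g ⟨+⟩ h ⟧ n k ≡ ⟦ g ⟧ n k ℤ.+ ⟦ h ⟧ n k
⟦⟧-+ g h n k = trans (cong (λ f → coefficient 0ℤ f k) (coefficient-merge (λ _ → refl) merge-identityʳ g h n))
  (coefficient-merge ℤ.+-identityˡ ℤ.+-identityʳ (coefficient [] g n) (coefficient [] h n) k)

⟦⟧-neg : ∀ h n k → ⟦ ⟨-⟩ h ⟧ n k ≡ ℤ.- ⟦ h ⟧ n k
⟦⟧-neg h n k = trans (cong (λ f → coefficient 0ℤ f k) (coefficient-map (map (ℤ.-_)) refl h n))
  (coefficient-map (ℤ.-_) refl (coefficient [] h n) k)

open ℤ⟦q⟧-Properties using (_⊠_; var^0-⊠; var^suc-⊠-zero; var^suc-⊠-suc)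

coefficient-q^ : ∀ n f k → coefficient 0ℤ (replicate n 0ℤ ++ f) k ≡ (q^ n ⊠ coefficient 0ℤ f) k
coefficient-q^ zero    f k       = sym (var^0-⊠ (coefficient 0ℤ f) k)
coefficient-q^ (suc n) f zero    = sym (var^suc-⊠-zero n (coefficient 0ℤ f))
coefficient-q^ (suc n) f (suc k) = trans (coefficient-q^ n f k) (sym (var^suc-⊠-suc n (coefficient 0ℤ f) k))

⟦⟧-q^t : ∀ n h m k → ⟦ q^ n t· h ⟧ (suc m) k ≡ (q^ n ⊠ ⟦ h ⟧ m) k
⟦⟧-q^t n []      m       k = trans (sym (coefficient-zeros n k))
  (trans (cong (λ f → coefficient 0ℤ f k) (sym (++-identityʳ (replicate n 0ℤ)))) (coefficient-q^ n [] k))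
  where
  coefficient-zeros : ∀ n k → coefficient 0ℤ (replicate n 0ℤ) k ≡ 0ℤ
  coefficient-zeros zero    k       = refl
  coefficient-zeros (suc n) zero    = refl
  coefficient-zeros (suc n) (suc k) = coefficient-zeros n k
⟦⟧-q^t n (f ∷ h) zero    k = coefficient-q^ n f k
⟦⟧-q^t n (f ∷ h) (suc m) k = ⟦⟧-q^t n h m k

total-+ : ∀ g h → total total₁ (g ⟨+⟩ h) ≡ total total₁ g ℤ.+ total total₁ h
total-+ = total-merge total₁ (total-merge id (λ _ _ → refl))

total-neg : ∀ h → total total₁ (⟨-⟩ h) ≡ ℤ.- total total₁ h
total-neg = total-map-neg total₁ (total-map-neg id (λ _ → refl))

total-q^t : ∀ n h → total total₁ (q^ n t· h) ≡ total total₁ h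
total-q^t n h = trans (total-prepend total₁ {[]} refl (map (replicate n 0ℤ ++_) h)) (total-map total₁ (total-zeros n) h)
  where
  total-zeros : ∀ n f → total₁ (replicate n 0ℤ ++ f) ≡ total₁ f
  total-zeros zero    f = refl
  total-zeros (suc n) f = trans (total-prepend id {0ℤ} refl (replicate n 0ℤ ++ f)) (total-zeros n f)

-- Ballot numbers and the polynomials behind `φ`

module _ (e : ℕ) where
  open Gaussian.OneBoundary e hiding (C)

  -- For b ≤ a + e, the reflection principle: the lattice paths from (0 , 0) to (a , b) that avoid
  -- the line b = a + e + 1.
  ballot : ℕ → ℕ → ℤ
  ballot a b = + ((a + b) C a) ℤ.- + ((a + b) C (a + e + 1))

  ballot-leftEdge : ∀ {b} → b ≤ e → ballot 0 b ≡ 1ℤ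
  ballot-leftEdge {b} b≤e rewrite k>n⇒nCk≡0 {b} {e + 1} (ℕ.≤-trans (s≤s b≤e) (ℕ.≤-reflexive (ℕ.+-comm 1 e)))
    | nCk≡nC[n∸k] {0} {b} z≤n | nCn≡1 b = refl

  ballot-bottomEdge : ∀ a → ballot a 0 ≡ 1ℤ
  ballot-bottomEdge a rewrite ℕ.+-identityʳ a
    | k>n⇒nCk≡0 {a} {a + e + 1} (ℕ.≤-trans (s≤s (ℕ.m≤m+n a e)) (ℕ.≤-reflexive (ℕ.+-comm 1 (a + e)))) | nCn≡1 a = refl

  pascal : ∀ n k → + (suc n C suc k) ≡ + (n C k) ℤ.+ + (n C suc k)
  pascal n k = trans (cong +_ (sym (nCk+nC[k+1]≡[n+1]C[k+1] n k))) (ℤ.pos-+ (n C k) (n C suc k))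

  ballot-recurrence : ∀ a b → ballot (suc a) (suc b) ≡ ballot a (suc b) ℤ.+ ballot (suc a) b
  ballot-recurrence a b rewrite ℕ.+-suc a b
    | pascal (suc (a + b)) a | pascal (suc (a + b)) (a + e + 1) =
    rearrange (+ (suc (a + b) C a)) (+ (suc (a + b) C suc a))
              (+ (suc (a + b) C (a + e + 1))) (+ (suc (a + b) C suc (a + e + 1)))
    where
    rearrange : ∀ x y z w → (x ℤ.+ y) ℤ.- (z ℤ.+ w) ≡ (x ℤ.- z) ℤ.+ (y ℤ.- w)
    rearrange = solve-∀

  -- The difference is C(2a+e+1, a) − C(2a+e+1, a+e+1) = 0.
  ballot-boundary : ∀ a → ballot (suc a) (suc (a + e)) ≡ ballot (suc a) (a + e)
  ballot-boundary a rewrite ℕ.+-suc a (a + e)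
    | pascal (suc (a + (a + e))) a | pascal (suc (a + (a + e))) (a + e + 1)
    | ℕ.+-comm (a + e) 1 =
    trans (cong (λ z → (+ z ℤ.+ + (n C suc a)) ℤ.- (+ (n C suc (a + e)) ℤ.+ + (n C suc (suc (a + e))))) symmetric)
          (rearrange (+ (n C suc (a + e))) (+ (n C suc a)) (+ (n C suc (suc (a + e)))))
    where
    n : ℕ
    n = suc (a + (a + e))
    symmetric : n C a ≡ n C suc (a + e)
    symmetric = trans (nCk≡nC[n∸k] (ℕ.m≤n⇒m≤1+n (ℕ.m≤m+n a (a + e))))
      (cong (n C_) (trans (ℕ.+-∸-assoc 1 (ℕ.m≤m+n a (a + e))) (cong suc (ℕ.m+n∸m≡n a (a + e)))))
    rearrange : ∀ x y z → (x ℤ.+ y) ℤ.- (x ℤ.+ z) ≡ y ℤ.- z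
    rearrange = solve-∀

  1≋δ₀ : ∀ n k → ⟦ (1ℤ ∷ []) ∷ [] ⟧ n k ≡ δ₀ n k
  1≋δ₀ zero    zero    = refl
  1≋δ₀ zero    (suc k) = refl
  1≋δ₀ (suc n) k       = refl

  -- `φ` is built with inverses of 1 - q^v and is a priori only a series in q. Building a list along
  -- the recursion shows that it is a polynomial and yields its value at q = t = 1 in the same
  -- induction.
  polynomial : ∀ a b → b ≤ a + e → ∃ λ h → ⟦ h ⟧ ≋ φ a b × evaluate h 1ℤ 1ℤ ≡ ballot a b
  polynomial zero    b    b≤e = (1ℤ ∷ []) ∷ [] , (λ n k → trans (1≋δ₀ n k) (sym (φ-leftEdge b≤e n k))) , sym (ballot-leftEdge b≤e)
  polynomial (suc a) zero _   = (1ℤ ∷ []) ∷ [] , (λ n k → trans (1≋δ₀ n k) (sym (φ-bottomEdge (suc a) n k))) , sym (ballot-bottomEdge (suc a))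
  polynomial (suc a) (suc b) (s≤s b≤a+e) with ℕ.m≤n⇒m<n∨m≡n b≤a+e
  ... | inj₂ refl = let (h , h≋ , h≡) = polynomial (suc a) b (ℕ.m≤n⇒m≤1+n b≤a+e) in
    h , (λ n k → trans (h≋ n k) (sym (φ-boundary a n k))) , trans h≡ (sym (ballot-boundary a))
  ... | inj₁ b<a+e =
    let (h₁ , h₁≋ , h₁≡) = polynomial a (suc b) b<a+e
        (h₂ , h₂≋ , h₂≡) = polynomial (suc a) b (ℕ.m≤n⇒m≤1+n b≤a+e)
        -- `h₃` enters through q^(a+b+1) t h₃ - h₃, which vanishes at q = t = 1 and so leaves the
        -- recursion of the ballot numbers.
        (h₃ , h₃≋ , _)   = polynomial a b b≤a+e
    in recurrence h₁ h₂ h₃ h₁≋ h₂≋ h₃≋ , recurrence-≋ h₁ h₂ h₃ h₁≋ h₂≋ h₃≋ ,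
       trans (recurrence-evaluate h₁ h₂ h₃ h₁≋ h₂≋ h₃≋) (trans (cong₂ ℤ._+_ h₁≡ h₂≡) (sym (ballot-recurrence a b)))
    where
    module _ h₁ h₂ h₃ (h₁≋ : ⟦ h₁ ⟧ ≋ φ a (suc b)) (h₂≋ : ⟦ h₂ ⟧ ≋ φ (suc a) b) (h₃≋ : ⟦ h₃ ⟧ ≋ φ a b) where
      step : ℤ[q,t]
      step = q^ suc (a + b) t· h₃
      recurrence : ℤ[q,t]
      recurrence = h₁ ⟨+⟩ h₂ ⟨+⟩ (step ⟨+⟩ ⟨-⟩ h₃)
      step≋ : ∀ n k → ⟦ step ⟧ n k ≡ shift (suc (a + b)) (φ a b) n k
      step≋ zero    k = refl
      step≋ (suc n) k = trans (⟦⟧-q^t (suc (a + b)) h₃ n k)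
        (ℤ⟦q⟧-Properties.⊠-cong {q^ suc (a + b)} {q^ suc (a + b)} {⟦ h₃ ⟧ n} {φ a b n} (λ _ → refl) (h₃≋ n) k)
      a+e-nonZero : NonZero (a + e)
      a+e-nonZero = >-nonZero (ℕ.≤-trans (s≤s z≤n) b<a+e)
      recurrence-≋ : ⟦ recurrence ⟧ ≋ φ (suc a) (suc b)
      recurrence-≋ n k = begin
        ⟦ recurrence ⟧ n k
          ≡⟨ trans (⟦⟧-+ (h₁ ⟨+⟩ h₂) (step ⟨+⟩ ⟨-⟩ h₃) n k) (cong₂ ℤ._+_ (⟦⟧-+ h₁ h₂ n k)
               (trans (⟦⟧-+ step (⟨-⟩ h₃) n k) (cong (λ x → ⟦ step ⟧ n k ℤ.+ x) (⟦⟧-neg h₃ n k)))) ⟩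
        (⟦ h₁ ⟧ n k ℤ.+ ⟦ h₂ ⟧ n k) ℤ.+ (⟦ step ⟧ n k ℤ.- ⟦ h₃ ⟧ n k)
          ≡⟨ cong₂ ℤ._+_ (cong₂ ℤ._+_ (h₁≋ n k) (h₂≋ n k)) (cong₂ ℤ._-_ (step≋ n k) (h₃≋ n k)) ⟩
        (φ a (suc b) n k ℤ.+ φ (suc a) b n k) ℤ.+ (shift (suc (a + b)) (φ a b) n k ℤ.- φ a b n k)
          ≡⟨ ℤ.+-assoc (φ a (suc b) n k ℤ.+ φ (suc a) b n k) (shift (suc (a + b)) (φ a b) n k) (ℤ.- φ a b n k) ⟨
        ((φ a (suc b) n k ℤ.+ φ (suc a) b n k) ℤ.+ shift (suc (a + b)) (φ a b) n k) ℤ.- φ a b n k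
          ≡⟨ cong (ℤ._- φ a b n k) (φ-recurrence {a} {b} (sym (ℕ.suc-pred (a + e) {{a+e-nonZero}})) n k) ⟨
        (φ (suc a) (suc b) n k ℤ.+ φ a b n k) ℤ.- φ a b n k
          ≡⟨ trans (ℤ.+-assoc (φ (suc a) (suc b) n k) (φ a b n k) _)
               (trans (cong (λ x → φ (suc a) (suc b) n k ℤ.+ x) (ℤ.+-inverseʳ (φ a b n k))) (ℤ.+-identityʳ _)) ⟩
        φ (suc a) (suc b) n k ∎
        where open ≡-Reasoning
      recurrence-evaluate : evaluate recurrence 1ℤ 1ℤ ≡ evaluate h₁ 1ℤ 1ℤ ℤ.+ evaluate h₂ 1ℤ 1ℤ
      recurrence-evaluate = begin
        total total₁ recurrence
          ≡⟨ trans (total-+ (h₁ ⟨+⟩ h₂) (step ⟨+⟩ ⟨-⟩ h₃))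
               (cong₂ ℤ._+_ (total-+ h₁ h₂) (total-+ step (⟨-⟩ h₃))) ⟩
        (total total₁ h₁ ℤ.+ total total₁ h₂) ℤ.+ (total total₁ step ℤ.+ total total₁ (⟨-⟩ h₃))
          ≡⟨ cong (λ x → total total₁ h₁ ℤ.+ total total₁ h₂ ℤ.+ x)
               (trans (cong₂ ℤ._+_ (total-q^t (suc (a + b)) h₃) (total-neg h₃)) (ℤ.+-inverseʳ (total total₁ h₃))) ⟩
        (total total₁ h₁ ℤ.+ total total₁ h₂) ℤ.+ 0ℤ
          ≡⟨ ℤ.+-identityʳ _ ⟩
        total total₁ h₁ ℤ.+ total total₁ h₂ ∎
        where open ≡-Reasoning

-- Intervals of the trapezoidal poset

module TrapezoidInterval (r s : ℕ) (2≤2r : 2 ≤ 2 * r) (2r≤s : 2 * r ≤ s) (x y : Cell r s) (x⊴y : x ⊴ y) where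

  P : GradedPoset
  P = interval (trapezoid r s 2≤2r 2r≤s) x y x⊴y

  open GradedPoset P

  i c j d e : ℕ
  i = row x
  c = col x
  j = row y
  d = col y
  e = s ∸ i ∸ c

  i≤r : i ≤ r
  i≤r = proj₂ (proj₁ (proj₂ x))
  i≤c : i ≤ c
  i≤c = proj₁ (proj₂ (proj₂ x))
  c≤s∸i : c ≤ s ∸ i
  c≤s∸i = proj₂ (proj₂ (proj₂ x))
  i≤s : i ≤ s
  i≤s = ℕ.≤-trans i≤r (ℕ.≤-trans (ℕ.m≤m+n r _) 2r≤s)

  p w : Carrier → ℕ
  p (z , _) = i ∸ row z
  w (z , _) = col z ∸ c

  monotone : ∀ {z z′} → z ⊑ z′ → p z ≤ p z′ × w z ≤ w z′
  monotone (row≥ , col≤) = ℕ.∸-monoʳ-≤ i row≥ , ℕ.∸-monoˡ-≤ c col≤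

  reflecting : ∀ {z z′} → p z ≤ p z′ → w z ≤ w z′ → z ⊑ z′
  reflecting {z , (_ , c≤z) , _} {z′ , (z′≤i , c≤z′) , _} p≤ w≤ =
    ℕ.∸-cancelʳ-≤ z′≤i p≤ ,
    ℕ.≤-trans (ℕ.≤-reflexive (sym (ℕ.m∸n+n≡m c≤z)))
      (ℕ.≤-trans (ℕ.+-monoˡ-≤ c w≤) (ℕ.≤-reflexive (ℕ.m∸n+n≡m c≤z′)))

  -- The wall col ≤ s - row of the trapezoid, seen from `x`: going up i - a rows moves the wall i -
  -- a columns to the right of its distance `e` at `x`.
  bounded : ∀ z → w z ≤ p z + e
  bounded (((a , b) , _ , (_ , b≤s∸a)) , (a≤i , _) , _) =
    ℕ.≤-trans (ℕ.∸-monoˡ-≤ c (ℕ.≤-trans b≤s∸a s∸a≤)) (ℕ.≤-reflexive (ℕ.+-∸-assoc (i ∸ a) c≤s∸i))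
    where
    s∸a≤ : s ∸ a ≤ (i ∸ a) + (s ∸ i)
    s∸a≤ = ℕ.m≤n+o⇒m∸n≤o s a (ℕ.≤-trans (ℕ.m≤n+m∸n s i)
      (ℕ.≤-reflexive (trans (cong (_+ (s ∸ i)) (sym (ℕ.m+[n∸m]≡n a≤i))) (ℕ.+-assoc a (i ∸ a) (s ∸ i)))))

  rank≡ : ∀ z → rank z ≡ p z + w z
  rank≡ (((a , b) , _) , (a≤i , c≤b) , _) = displacement a≤i i≤c c≤b
    where
    displacement : ∀ {a i c b} → a ≤ i → i ≤ c → c ≤ b → (b ∸ a) ∸ (c ∸ i) ≡ (i ∸ a) + (b ∸ c)
    displacement {a} {i} {c} {b} a≤i i≤c c≤b
      with ℕ.m≤n⇒∃[o]m+o≡n a≤i | ℕ.m≤n⇒∃[o]m+o≡n i≤c | ℕ.m≤n⇒∃[o]m+o≡n c≤b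
    ... | k , refl | l , refl | n , refl
      rewrite ℕ.m+n∸m≡n a k | ℕ.m+n∸m≡n (a + k) l | ℕ.m+n∸m≡n (a + k + l) n
            | ℕ.+-assoc (a + k) l n | ℕ.+-assoc a k (l + n) | ℕ.m+n∸m≡n a (k + (l + n))
            | ℕ.+-comm l n | sym (ℕ.+-assoc k n l) = ℕ.m+n∸n≡m (k + n) l

  -- The witness is row i - a, column c + b. The wall row ≤ col never interferes, since rows only
  -- decrease and columns only grow from `x`, where i ≤ c; this is why the interval has a single
  -- slanted boundary. The other wall is the hypothesis b ≤ a + e.
  cell : ∀ z {a b} → a ≤ p z → b ≤ w z → b ≤ a + e → ∃ λ z′ → p z′ ≡ a × w z′ ≡ b
  cell (z , (z≤i , c≤z) , (j≤z , z≤d)) {a} {b} a≤p b≤w b≤a+e =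
    ( ((i ∸ a , c + b) , (ℕ.≤-trans (proj₁ (proj₁ (proj₂ z))) row≤ , ℕ.≤-trans (ℕ.m∸n≤m i a) i≤r)
                       , (ℕ.≤-trans (ℕ.m∸n≤m i a) (ℕ.≤-trans i≤c (ℕ.m≤m+n c b)) , col≤s∸row))
    , (ℕ.m∸n≤m i a , ℕ.m≤m+n c b)
    , (ℕ.≤-trans j≤z row≤ , ℕ.≤-trans col≤ z≤d))
    , ℕ.m∸[m∸n]≡n a≤i , ℕ.m+n∸m≡n c b
    where
    a≤i : a ≤ i
    a≤i = ℕ.≤-trans a≤p (ℕ.m∸n≤m i (row z))
    row≤ : row z ≤ i ∸ a
    row≤ = ℕ.m+n≤o⇒m≤o∸n (row z) (ℕ.≤-trans (ℕ.≤-reflexive (ℕ.+-comm (row z) a)) (ℕ.m≤o∸n⇒m+n≤o a z≤i a≤p))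
    col≤ : c + b ≤ col z
    col≤ = ℕ.≤-trans (ℕ.+-monoʳ-≤ c b≤w) (ℕ.≤-reflexive (ℕ.m+[n∸m]≡n c≤z))
    col≤s∸row : c + b ≤ s ∸ (i ∸ a)
    col≤s∸row = ℕ.m+n≤o⇒m≤o∸n (c + b) (begin
      c + b + (i ∸ a)               ≤⟨ ℕ.+-monoˡ-≤ (i ∸ a) (ℕ.+-monoʳ-≤ c b≤a+e) ⟩
      c + (a + e) + (i ∸ a)         ≡⟨ NS.solve 4 (λ c a e f → c NS.:+ (a NS.:+ e) NS.:+ f NS.:= (c NS.:+ e) NS.:+ (a NS.:+ f)) refl c a e (i ∸ a) ⟩
      (c + e) + (a + (i ∸ a))       ≡⟨ cong₂ _+_ (ℕ.m+[n∸m]≡n c≤s∸i) (ℕ.m+[n∸m]≡n a≤i) ⟩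
      (s ∸ i) + i                   ≡⟨ ℕ.m∸n+n≡m i≤s ⟩
      s ∎)
      where open ℕ.≤-Reasoning

  coordinates : RegionCoordinates P e
  coordinates = record
    { p          = p
    ; w          = w
    ; monotone   = λ {z} {z′} → monotone {z} {z′}
    ; reflecting = λ {z} {z′} → reflecting {z} {z′}
    ; bounded    = bounded
    ; rank≡      = rank≡
    ; cell       = cell
    }

  open Region ℤ⟦q⟧-ring ℤ⟦q⟧-powers P e coordinates
  open Gaussian.OneBoundary e using (φ)

  ℓ u : ℕ
  ℓ = i ∸ j
  u = d ∸ c

  module QTᵣ = Ring QT.rawRing

  denominator : ℤ⟦q⟧⟦t⟧
  denominator = D (suc maximalRank)

  chainSeries-F : chainSeries P ≋ F top
  chainSeries-F m = chains-below-maximum top-maximum m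

  chainSeries-φ : chainSeries P QTᵣ.* denominator ≋ φ ℓ u
  chainSeries-φ n k = trans
    (SeriesRing.*-cong {chainSeries P} {F top} {denominator} {denominator} chainSeries-F (λ _ _ → refl) n k)
    (numerator-φ ℓ u top refl refl n k)

  numerator-exists : ∃ (IsNumerator P)
  numerator-exists = let (h , h≋ , _) = polynomial e ℓ u (bounded top) in
    h , λ n k → trans (chainSeries-φ n k) (sym (h≋ n k))

  numerator-≋ : ∀ h → IsNumerator P h → ⟦ h ⟧ ≋ φ ℓ u
  numerator-≋ h isNum n k = trans (sym (isNum n k)) (chainSeries-φ n k)

  numerator-Φ : ∀ h → IsNumerator P h → ⟦ h ⟧ ≋ Φ ℓ u e
  numerator-Φ h isNum n k = trans (numerator-≋ h isNum n k) (Φ-φ e ℓ u (bounded top) n k)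

  numerator-evaluate : ∀ h → IsNumerator P h →
    evaluate h 1ℤ 1ℤ ≡ + ((ℓ + u) C ℓ) ℤ.- + ((ℓ + u) C (ℓ + e + 1))
  numerator-evaluate h isNum = let (g , g≋ , g≡) = polynomial e ℓ u (bounded top) in
    trans (evaluate-cong h g (λ n k → trans (numerator-≋ h isNum n k) (sym (g≋ n k)))) g≡

theorem4p3 : (r s : ℕ) (2≤2r : 2 ≤ 2 * r) (2r≤s : 2 * r ≤ s) (x y : Cell r s) (x⊴y : x ⊴ y) →
    let ℓ = row x ∸ row y
        u = col y ∸ col x
        δ = s ∸ row x ∸ col x
        P = interval (trapezoid r s 2≤2r 2r≤s) x y x⊴y
    in
    (∃ λ h → IsNumerator P h) ×
    (∀ h → IsNumerator P h →
      ⟦ h ⟧ ≋ Φ ℓ u δ ×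
      evaluate h 1ℤ 1ℤ ≡ + ((ℓ + u) C ℓ) ℤ.- + ((ℓ + u) C (ℓ + δ + 1)) ×
      ((r′ s′ : ℕ) (2≤2r′ : 2 ≤ 2 * r′) (2r′≤s′ : 2 * r′ ≤ s′)
       (x′ y′ : Cell r′ s′) (x′⊴y′ : x′ ⊴ y′) →
       row x′ ∸ row y′ ≡ ℓ →
       col y′ ∸ col x′ ≡ u →
       s′ ∸ row x′ ∸ col x′ ≡ δ →
       ∀ h′ → IsNumerator (interval (trapezoid r′ s′ 2≤2r′ 2r′≤s′) x′ y′ x′⊴y′) h′ →
       ⟦ h′ ⟧ ≋ ⟦ h ⟧))
theorem4p3 r s 2≤2r 2r≤s x y x⊴y =
  numerator-exists ,
  λ h isNum → numerator-Φ h isNum , numerator-evaluate h isNum ,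
    λ r′ s′ 2≤2r′ 2r′≤s′ x′ y′ x′⊴y′ ℓ≡ u≡ δ≡ h′ isNum′ n k →
      trans (TrapezoidInterval.numerator-Φ r′ s′ 2≤2r′ 2r′≤s′ x′ y′ x′⊴y′ h′ isNum′ n k)
        (trans (Φ-cong ℓ≡ u≡ δ≡ n k) (sym (numerator-Φ h isNum n k)))
  where
  open TrapezoidInterval r s 2≤2r 2r≤s x y x⊴y
  Φ-cong : ∀ {a a′ b b′ δ δ′} → a ≡ a′ → b ≡ b′ → δ ≡ δ′ → ∀ n k → Φ a b δ n k ≡ Φ a′ b′ δ′ n k
  Φ-cong refl refl refl n k = refl
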